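{- Let $V$ be a commutative generalized bijective variety in the language $L=\{f_1,\ldots,f_n\}$ of unary function symbols, and consider presentations with a single generator $a$ and a single identity $t(a)=t'(a)$. Let $F$ be the free structure in $V$ on $a$. If $F$ is infinite, then every elementary first-order $L$-sentence true in $F$ has limiting density $1$.
   Context: A variety is a class of structures, in a language with only function symbols and constants, axiomatized by universally quantified equations; its theory $T$ is the set of logical consequences of the axioms. Let $L=\{f_1,\ldots,f_n\}$ consist of unary function symbols. A variety $V$ with theory $T$ is generalized bijective if for each $i$, $T\vdash(\forall x,y)(f_i(x)=f_i(y)\to x=y)$ and $T\vdash(\forall y)(\exists x)\,f_i(x)=y$. It is commutative if $T\vdash(\forall x)\,f_i(f_j(x))=f_j(f_i(x))$ for all $i,j$. A presentation $a|R$ consists of a generator $a$ and one identity $R$ of the form $t(a)=t'(a)$, where $t,t'$ are arbitrary (possibly empty) finite strings of symbols from $f_1,\ldots,f_n$; identities are counted as ordered pairs $(t,t')$ of strings. The structure $\langle a|R\rangle$ is the member of $V$ generated by $a$ in which the equations between closed terms in $a$ that hold are exactly those that follow logically from $T\cup\{R\}$. The free structure on $a$ is the one given by the empty set of identities. The length of $t(a)=t'(a)$ is the total number of occurrences of function symbols in $t$ and $t'$. Let $P_s$ be the number of presentations whose identity has length at most $s$ and $P_s(\varphi)$ the number of these for which $\langle a|R\rangle\models\varphi$. The sentence $\varphi$ has limiting density $d$ if $\lim_{s\to\infty}P_s(\varphi)/P_s=d$. -}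

module Defs where

open import Level using (Level; 0ℓ; _⊔_) renaming (suc to lsuc)
open import Axiom.ExcludedMiddle using (ExcludedMiddle)
open import Algebra.Core using (Op₁)
open import Data.Empty.Polymorphic using (⊥)
open import Data.Fin.Base using (Fin; zero; suc)
open import Data.Integer.Base using (+_)
open import Data.List.Base
  using (List; []; _∷_; length; foldr; filter; concatMap; upTo; allFin;
         cartesianProduct; cartesianProductWith)
open import Data.List.Membership.Propositional using (_∈_; lose; find)
open import Data.List.Membership.Propositional.Properties
  using (∈-concatMap⁺; ∈-concatMap⁻; ∈-cartesianProductWith⁺;
         ∈-cartesianProductWith⁻; ∈-cartesianProduct⁺; ∈-cartesianProduct⁻;
         ∈-upTo⁺; ∈-upTo⁻; ∈-allFin)
open import Data.List.Properties using (∷-injective)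
open import Data.List.Relation.Unary.Enumerates.Setoid using (IsEnumeration)
import Data.List.Relation.Unary.All as All
import Data.List.Relation.Unary.All.Properties as All
import Data.List.Relation.Unary.AllPairs as AllPairs
import Data.List.Relation.Unary.AllPairs.Properties as AllPairs
open import Data.List.Relation.Unary.Any using (here)
open import Data.List.Relation.Unary.Unique.Propositional using (Unique)
open import Data.List.Relation.Unary.Unique.Propositional.Properties
  using (concat⁺; cartesianProductWith⁺; cartesianProduct⁺; allFin⁺; upTo⁺)
open import Data.Nat.Base as ℕ using (ℕ; zero; suc; _∸_; s≤s; NonZero)
import Data.Nat.Properties as ℕ
open import Data.Product.Base using (Σ; _×_; _,_; proj₁; proj₂; ∃-syntax)
open import Data.Rational.Unnormalised.Base as ℚ using (ℚᵘ; 0ℚᵘ; _/_; ∣_∣)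
open import Data.Sum.Base using (_⊎_)
open import Data.Vec.Functional as Vector using (Vector)
open import Function.Base using (_∘_)
open import Relation.Binary.Bundles using (Setoid)
open import Relation.Binary.Core using (Rel)
open import Relation.Binary.PropositionalEquality
  using (_≡_; refl; sym; trans; cong; subst)
open import Relation.Binary.Structures using (IsEquivalence)
open import Relation.Nullary.Negation using (¬_)
open import Relation.Unary using (Pred; ∅; ｛_｝)

-- The language is { f_i | i : Fin n }.

-- The word i₁ ∷ … ∷ i_k ∷ [] stands for the string f_{i₁} … f_{i_k}.
Word : ℕ → Set
Word n = List (Fin n)

-- As all symbols are unary, a term is a string applied to one variable.
infix 8 _·_
record Term (n : ℕ) (X : Set) : Set where
  constructor _·_
  field
    word : Word n
    var  : X

infix  7 _≐_
infixr 6 _∧_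
infixr 5 _∨_
infixr 4 _⇒_

-- Formulas with free de Bruijn variables in Fin m; in the body of a
-- quantifier, index zero is the variable bound by that quantifier.
data Formula (n m : ℕ) : Set where
  ⊥′      : Formula n m
  _≐_     : Term n (Fin m) → Term n (Fin m) → Formula n m
  _∧_ _∨_ _⇒_ : Formula n m → Formula n m → Formula n m
  ∀′_ ∃′_ : Formula n (suc m) → Formula n m

Sentence : ℕ → Set
Sentence n = Formula n 0

-- Setoid equality interprets the equality symbol; as usual in first-order
-- logic, structures are non-empty.
record Structure (n : ℕ) (c ℓ : Level) : Set (lsuc (c ⊔ ℓ)) where
  infix 4 _≈_
  field
    Carrier       : Set c
    _≈_           : Rel Carrier ℓ
    isEquivalence : IsEquivalence _≈_
    op            : Fin n → Op₁ Carrier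
    op-cong       : ∀ i {x y} → x ≈ y → op i x ≈ op i y
    inhabitant    : Carrier

  setoid : Setoid c ℓ
  setoid = record { isEquivalence = isEquivalence }

  act : Word n → Op₁ Carrier
  act w x = foldr op x w

  ⟦_⟧ : ∀ {X : Set} → Term n X → (X → Carrier) → Carrier
  ⟦ w · x ⟧ ρ = act w (ρ x)

module _ {n : ℕ} {c ℓ : Level} (M : Structure n c ℓ) where
  open Structure M

  Sat : ∀ {m} → Formula n m → Vector Carrier m → Set (c ⊔ ℓ)
  Sat ⊥′      ρ = ⊥
  Sat (t ≐ u) ρ = Level.Lift c (⟦ t ⟧ ρ ≈ ⟦ u ⟧ ρ)
  Sat (φ ∧ ψ) ρ = Sat φ ρ × Sat ψ ρ
  Sat (φ ∨ ψ) ρ = Sat φ ρ ⊎ Sat ψ ρ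
  Sat (φ ⇒ ψ) ρ = Sat φ ρ → Sat ψ ρ
  Sat (∀′ φ)  ρ = ∀ x → Sat φ (x Vector.∷ ρ)
  Sat (∃′ φ)  ρ = Σ Carrier λ x → Sat φ (x Vector.∷ ρ)

infix 3 _⊨_
_⊨_ : ∀ {n c ℓ} → Structure n c ℓ → Sentence n → Set (c ⊔ ℓ)
M ⊨ φ = Sat M φ Vector.[]

Infinite : ∀ {n c ℓ} → Structure n c ℓ → Set (c ⊔ ℓ)
Infinite M = ¬ (∃[ xs ] IsEnumeration (Structure.setoid M) xs)

-- A variety is given by an arbitrary set of equational axioms, in variables
-- named by ℕ and understood to be universally quantified.
Equation : ℕ → Set
Equation n = Term n ℕ × Term n ℕ

Axioms : ℕ → Set₁
Axioms n = Pred (Equation n) 0ℓ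

infix 4 _∈Variety_
_∈Variety_ : ∀ {n c ℓ} → Structure n c ℓ → Axioms n → Set (c ⊔ ℓ)
M ∈Variety E = ∀ {t u} → E (t , u) → ∀ ρ → ⟦ t ⟧ ρ ≈ ⟦ u ⟧ ρ
  where open Structure M

-- Membership of a sentence in the theory T, i.e. logical consequence of E.
infix 3 _⊢_
_⊢_ : ∀ {n} → Axioms n → Sentence n → Set₁
E ⊢ φ = ∀ (M : Structure _ 0ℓ 0ℓ) → M ∈Variety E → M ⊨ φ

GeneralizedBijective : ∀ {n} → Axioms n → Set₁
GeneralizedBijective E = ∀ i →
    (E ⊢ ∀′ ∀′ ((i ∷ []) · suc zero ≐ (i ∷ []) · zero
                  ⇒ [] · suc zero ≐ [] · zero))
  × (E ⊢ ∀′ ∃′ ((i ∷ []) · zero ≐ [] · suc zero))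

Commutative : ∀ {n} → Axioms n → Set₁
Commutative E = ∀ i j →
  E ⊢ ∀′ ((i ∷ j ∷ []) · zero ≐ (j ∷ i ∷ []) · zero)

-- The pair (t , t′) stands for the identity t(a) = t′(a).
Identity : ℕ → Set
Identity n = Word n × Word n

module _ {n : ℕ} (E : Axioms n) where

  -- The equation t(a) = u(a) follows logically from T ∪ S; a model of T ∪ S
  -- in the language with the added constant is a member M of the variety
  -- together with an interpretation a of the constant.
  Follows : Pred (Identity n) 0ℓ → Word n → Word n → Set₁
  Follows S t u =
    ∀ (M : Structure n 0ℓ 0ℓ) (let open Structure M) →
    M ∈Variety E → ∀ a →
    (∀ {l r} → S (l , r) → act l a ≈ act r a) →
    act t a ≈ act u a

  -- Elements are the closed terms w(a), represented by w.
  Presented : Pred (Identity n) 0ℓ → Structure n 0ℓ (lsuc 0ℓ)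
  Presented S = record
    { Carrier       = Word n
    ; _≈_           = Follows S
    ; isEquivalence = record
      { refl  = λ M _ _ _ → IsEquivalence.refl (Structure.isEquivalence M)
      ; sym   = λ p M M∈V a s →
          IsEquivalence.sym (Structure.isEquivalence M) (p M M∈V a s)
      ; trans = λ p q M M∈V a s →
          IsEquivalence.trans (Structure.isEquivalence M)
            (p M M∈V a s) (q M M∈V a s)
      }
    ; op            = _∷_
    ; op-cong       = λ i p M M∈V a s → Structure.op-cong M i (p M M∈V a s)
    ; inhabitant    = []
    }

  Free : Structure n 0ℓ (lsuc 0ℓ)
  Free = Presented ∅

  ⟨a∣_⟩ : Identity n → Structure n 0ℓ (lsuc 0ℓ)
  ⟨a∣ R ⟩ = Presented ｛ R ｝

  Presented∈Variety : ∀ S → Presented S ∈Variety E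
  Presented∈Variety S {t · x} {u · y} e ρ M M∈V a s =
    IsEquivalence.trans isEquivalence (reflexive (act-act t (ρ x)))
      (IsEquivalence.trans isEquivalence (M∈V e (λ z → act (ρ z) a))
        (reflexive (sym (act-act u (ρ y)))))
    where
    open Structure M
    reflexive : ∀ {b c} → b ≡ c → b ≈ c
    reflexive refl = IsEquivalence.refl isEquivalence
    act-act : ∀ w v → act (foldr _∷_ v w) a ≡ act w (act v a)
    act-act []      v = refl
    act-act (i ∷ w) v = cong (op i) (act-act w v)

words : ∀ n → ℕ → List (Word n)
words n zero    = [] ∷ []
words n (suc k) = cartesianProductWith _∷_ (allFin n) (words n k)

identitiesOfLength : ∀ n → ℕ → List (Identity n)
identitiesOfLength n l =
  concatMap (λ k → cartesianProduct (words n k) (words n (l ∸ k))) (upTo (suc l))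

-- All identities of length at most s, each listed once (see ∈-identities⁺,
-- ∈-identities⁻ and identities-unique below).
identities : ∀ n → ℕ → List (Identity n)
identities n s = concatMap (identitiesOfLength n) (upTo (suc s))

P : ℕ → ℕ → ℕ
P n s = length (identities n s)

instance
  P-nonZero : ∀ {n s} → NonZero (P n s)
  P-nonZero = _

-- Excluded middle is what makes the number of presentations satisfying a
-- given sentence well defined, satisfaction not being decidable in general.
module _ (em : ExcludedMiddle (lsuc 0ℓ)) {n : ℕ} (E : Axioms n) where

  P[_] : Sentence n → ℕ → ℕ
  P[ φ ] s = length (filter (λ R → em {⟨a∣_⟩ E R ⊨ φ}) (identities n s))

  HasLimitingDensity : Sentence n → ℚᵘ → Set
  HasLimitingDensity φ d =
    ∀ ε → 0ℚᵘ ℚ.< ε → ∃[ N ] ∀ s → N ℕ.≤ s →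
    ∣ (+ P[ φ ] s / P n s) ℚ.- d ∣ ℚ.< ε

identityLength : ∀ {n} → Identity n → ℕ
identityLength (t , t′) = length t ℕ.+ length t′

private
  ∈-words⁺ : ∀ {n} (w : Word n) → w ∈ words n (length w)
  ∈-words⁺ []      = here refl
  ∈-words⁺ (i ∷ w) = ∈-cartesianProductWith⁺ _∷_ (∈-allFin i) (∈-words⁺ w)

  ∈-words⁻ : ∀ {n} k {w : Word n} → w ∈ words n k → length w ≡ k
  ∈-words⁻ zero    (here refl) = refl
  ∈-words⁻ {n} (suc k) p
    with _ , _ , _ , q , refl ← ∈-cartesianProductWith⁻ _∷_ (allFin n) (words n k) p
    = cong suc (∈-words⁻ k q)

  words-unique : ∀ n k → Unique (words n k)
  words-unique n zero    = All.[] AllPairs.∷ AllPairs.[]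
  words-unique n (suc k) =
    cartesianProductWith⁺ _∷_ ∷-injective (allFin⁺ n) (words-unique n k)

  concatMap-unique : ∀ {A B : Set} (f : A → List B) (key : B → A) →
                     (∀ x → Unique (f x)) → (∀ x {y} → y ∈ f x → key y ≡ x) →
                     ∀ {xs} → Unique xs → Unique (concatMap f xs)
  concatMap-unique f key f-unique f-key xs! = concat⁺
    (All.map⁺ (All.universal f-unique _))
    (AllPairs.map⁺ (AllPairs.map
      (λ { x≢y {_} (p , q) → x≢y (trans (sym (f-key _ p)) (f-key _ q)) }) xs!))

  ∈-ofLength⁻ : ∀ {n} l {R : Identity n} →
                R ∈ identitiesOfLength n l → identityLength R ≡ l
  ∈-ofLength⁻ {n} l p
    with k , k∈ , q ← find (∈-concatMap⁻ _ {xs = upTo (suc l)} p)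
    with q₁ , q₂ ← ∈-cartesianProduct⁻ (words n k) (words n (l ∸ k)) q
    rewrite ∈-words⁻ k q₁ | ∈-words⁻ (l ∸ k) q₂
    = ℕ.m+[n∸m]≡n (ℕ.≤-pred (∈-upTo⁻ k∈))

∈-identities⁺ : ∀ {n s} (R : Identity n) →
                identityLength R ℕ.≤ s → R ∈ identities n s
∈-identities⁺ {n} {s} (t , t′) len≤s =
  ∈-concatMap⁺ (identitiesOfLength n) (lose (∈-upTo⁺ (s≤s len≤s))
    (∈-concatMap⁺ (λ k → cartesianProduct (words n k)
                           (words n (length t ℕ.+ length t′ ∸ k))) (lose (∈-upTo⁺ (s≤s (ℕ.m≤m+n (length t) (length t′))))
      (∈-cartesianProduct⁺ (∈-words⁺ t)
        (subst (λ k → t′ ∈ words n k) (sym (ℕ.m+n∸m≡n (length t) (length t′)))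
          (∈-words⁺ t′))))))

∈-identities⁻ : ∀ {n s} {R : Identity n} →
                R ∈ identities n s → identityLength R ℕ.≤ s
∈-identities⁻ {n} {s} p
  with l , l∈ , q ← find (∈-concatMap⁻ _ {xs = upTo (suc s)} p)
  rewrite ∈-ofLength⁻ l q
  = ℕ.≤-pred (∈-upTo⁻ l∈)

identities-unique : ∀ n s → Unique (identities n s)
identities-unique n s = concatMap-unique _ identityLength
  (λ l → concatMap-unique _ (length ∘ proj₁)
    (λ k → cartesianProduct⁺ (words-unique n k) (words-unique n (l ∸ k)))
    (λ k p → ∈-words⁻ k
      (proj₁ (∈-cartesianProduct⁻ (words n k) (words n (l ∸ k)) p)))
    (upTo⁺ (suc l)))
  (λ l → ∈-ofLength⁻ l)
  (upTo⁺ (suc s))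

{-# OPTIONS --safe #-}
module Submission where

-- In V the free structure on one generator is a finitely generated abelian
-- group G on which the function symbols act as translations by generators.  As G
-- is infinite, some homomorphism, the weight, from G to ℤ is nonzero, and it is
-- not constant on the generators, because these have words for inverses.
--
-- The structure ⟨a | t = t′⟩ is the quotient of G by the multiples of t − t′.  If
-- a short pair of distinct elements u, v is identified in it, then u − v is a nonzero
-- multiple of t − t′, whence |weight (t − t′)| ≤ |weight (u − v)|.  So unless
-- |weight (t − t′)| is bounded by a constant depending only on the sentence, the
-- quotient agrees with G on all short words, and a back-and-forth argument in
-- the style of Ehrenfeucht and Fraïssé transfers the sentence from G.
--
-- It remains to see that |weight t − weight t′| ≤ N has density 0.  At least one of
-- t and t′ is long, and the weight of a long random word is not concentrated
-- on any bounded interval.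

open import Defs
open import Level using (0ℓ; lift; lower) renaming (suc to lsuc)
open import Axiom.ExcludedMiddle using (ExcludedMiddle)
open import Algebra.Bundles using (CommutativeMonoid)
import Algebra.Properties.CommutativeSemigroup as CommutativeSemigroupProperties
open import Data.Bool.Base using (Bool; true; false; if_then_else_; T)
open import Data.Bool.Properties using (T?)
open import Data.Empty using (⊥; ⊥-elim)
open import Data.Fin.Base as Fin using (Fin; zero; suc)
open import Data.Fin.Properties as Fin using (all?; ¬∀⟶∃¬; pigeonhole)
open import Data.Integer.Base as ℤ using (ℤ; 0ℤ; 1ℤ; ∣_∣; -[1+_]; +<+) renaming (+_ to pos)
import Data.Integer.Properties as ℤ
import Data.Integer.Tactic.RingSolver as ℤSolver
open import Data.List.Base hiding (sum)
open import Data.List.Membership.Propositional using (_∈_)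
open import Data.List.Membership.Propositional.Properties using (∈-∃++; ∈-applyUpTo⁻; ∈-cartesianProductWith⁺; ∈-cartesianProductWith⁻; ∈-cartesianProduct⁺; ∈-allFin; ∈-upTo⁺; ∈-upTo⁻)
open import Data.List.Properties using (map-++; length-replicate; length-++; length-applyUpTo; upTo-∷ʳ; concatMap-++; ++-identityʳ; ++-assoc; ++-is-foldr; id-is-foldr; length-filter)
open import Data.List.Relation.Unary.All as All using (All; []; _∷_)
open import Data.List.Relation.Unary.AllPairs as AllPairs using (AllPairs; []; _∷_)
import Data.List.Relation.Unary.AllPairs.Properties as AllPairs
open import Data.List.Relation.Unary.Any as Any using (index; here; there)
import Data.List.Relation.Unary.Any.Properties as Any
open import Data.List.Relation.Unary.Unique.Propositional using (Unique)
open import Data.Nat.Base as ℕ using (ℕ; zero; suc; _+_; _*_; _∸_; _≤_; _<_; _≤ᵇ_; _⊔_; z≤n; s≤s; NonZero)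
open import Data.Nat.ListAction using (sum)
open import Data.Nat.ListAction.Properties using (sum-++)
open import Data.Nat.Properties as ℕ hiding (_≟_; _≤?_)
import Data.Nat.Tactic.RingSolver as ℕSolver
open import Data.Product.Base using (_×_; _,_; proj₁; proj₂; ∃-syntax)
open import Data.Rational.Unnormalised.Base as ℚ using (mkℚᵘ; 1ℚᵘ; *<*)
open import Data.Sum.Base using (_⊎_; inj₁; inj₂)
import Data.Vec.Functional as Vector
open import Function.Base using (_∘_; const)
open import Relation.Binary.PropositionalEquality using (_≡_; _≢_; refl; sym; trans; cong; cong₂; subst; subst₂; module ≡-Reasoning)
import Relation.Binary.Reasoning.Setoid as ≈-Reasoning
open import Relation.Binary.Structures using (IsEquivalence)
open import Relation.Nullary
open import Relation.Nullary.Decidable using (True; toWitness; fromWitness)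
open import Relation.Unary using (Pred; ∅; ｛_｝; Decidable)

module +-CommutativeSemigroup = CommutativeSemigroupProperties ℕ.+-commutativeSemigroup

-- Finite sums

∑ : ∀ {A : Set} → List A → (A → ℕ) → ℕ
∑ xs f = sum (map f xs)

∑-++ : ∀ {A : Set} xs ys (f : A → ℕ) → ∑ (xs ++ ys) f ≡ ∑ xs f + ∑ ys f
∑-++ xs ys f = trans (cong sum (map-++ f xs ys)) (sum-++ (map f xs) (map f ys))

∑-map : ∀ {A B : Set} (g : A → B) xs (f : B → ℕ) → ∑ (map g xs) f ≡ ∑ xs (f ∘ g)
∑-map g []       f = refl
∑-map g (x ∷ xs) f = cong (f (g x) +_) (∑-map g xs f)

∑-concatMap : ∀ {A B : Set} (g : A → List B) xs (f : B → ℕ) →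
              ∑ (concatMap g xs) f ≡ ∑ xs λ x → ∑ (g x) f
∑-concatMap g []       f = refl
∑-concatMap g (x ∷ xs) f =
  trans (∑-++ (g x) (concatMap g xs) f) (cong (∑ (g x) f +_) (∑-concatMap g xs f))

∑-cartesianProductWith : ∀ {A B C : Set} (g : A → B → C) xs ys (f : C → ℕ) →
  ∑ (cartesianProductWith g xs ys) f ≡ ∑ xs λ x → ∑ ys λ y → f (g x y)
∑-cartesianProductWith g []       ys f = refl
∑-cartesianProductWith g (x ∷ xs) ys f = trans (∑-++ (map (g x) ys) _ f)
  (cong₂ _+_ (∑-map (g x) ys f) (∑-cartesianProductWith g xs ys f))

∑-mono : ∀ {A : Set} xs {f g : A → ℕ} → (∀ {x} → x ∈ xs → f x ≤ g x) → ∑ xs f ≤ ∑ xs g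
∑-mono []       f≤g = z≤n
∑-mono (x ∷ xs) f≤g = +-mono-≤ (f≤g (here refl)) (∑-mono xs (f≤g ∘ there))

∑-cong : ∀ {A : Set} xs {f g : A → ℕ} → (∀ x → f x ≡ g x) → ∑ xs f ≡ ∑ xs g
∑-cong []       f≡g = refl
∑-cong (x ∷ xs) f≡g = cong₂ _+_ (f≡g x) (∑-cong xs f≡g)

∑-const : ∀ {A : Set} (xs : List A) c → ∑ xs (const c) ≡ length xs * c
∑-const []       c = refl
∑-const (x ∷ xs) c = cong (c +_) (∑-const xs c)

∑-+ : ∀ {A : Set} xs (f g : A → ℕ) → ∑ xs (λ x → f x + g x) ≡ ∑ xs f + ∑ xs g
∑-+ []       f g = refl
∑-+ (x ∷ xs) f g =
  trans (cong (f x + g x +_) (∑-+ xs f g)) (+-CommutativeSemigroup.interchange (f x) (g x) _ _)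

∑-*ʳ : ∀ {A : Set} xs (f : A → ℕ) c → ∑ xs (λ x → f x * c) ≡ ∑ xs f * c
∑-*ʳ []       f c = refl
∑-*ʳ (x ∷ xs) f c =
  trans (cong (f x * c +_) (∑-*ʳ xs f c)) (sym (*-distribʳ-+ c (f x) (∑ xs f)))

∑-swap : ∀ {A B : Set} xs ys (f : A → B → ℕ) →
         ∑ xs (λ x → ∑ ys (f x)) ≡ ∑ ys λ y → ∑ xs λ x → f x y
∑-swap []       ys f = sym (trans (∑-const ys 0) (*-zeroʳ (length ys)))
∑-swap (x ∷ xs) ys f =
  trans (cong (∑ ys (f x) +_) (∑-swap xs ys f)) (sym (∑-+ ys (f x) _))

∑-length : ∀ {A : Set} (xs : List A) → ∑ xs (const 1) ≡ length xs
∑-length xs = trans (∑-const xs 1) (*-identityʳ (length xs))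

-- The head of `xs` is cancelled against one of its occurrences in `ys`. Since `xs` has no
-- repetitions, its other elements survive this removal and the induction continues.
∑-⊆ : ∀ {A : Set} (f : A → ℕ) {xs ys} → Unique xs → (∀ {x} → x ∈ xs → x ∈ ys) →
      ∑ xs f ≤ ∑ ys f
∑-⊆ f {[]}     {ys} _           _     = z≤n
∑-⊆ f {x ∷ xs} {ys} (x∉xs ∷ xs!) xs⊆ys with ∈-∃++ (xs⊆ys (here refl))
... | as , bs , refl = begin
  f x + ∑ xs f           ≤⟨ +-monoʳ-≤ (f x) (∑-⊆ f xs! xs⊆) ⟩
  f x + ∑ (as ++ bs) f   ≡⟨ cong (f x +_) (∑-++ as bs f) ⟩
  f x + (∑ as f + ∑ bs f) ≡⟨ +-CommutativeSemigroup.x∙yz≈y∙xz (f x) (∑ as f) (∑ bs f) ⟩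
  ∑ as f + (f x + ∑ bs f) ≡⟨ ∑-++ as (x ∷ bs) f ⟨
  ∑ (as ++ x ∷ bs) f     ∎
  where
  open ≤-Reasoning
  drop-x : ∀ cs {y} → x ≢ y → y ∈ cs ++ x ∷ bs → y ∈ cs ++ bs
  drop-x []       x≢y (here refl) = ⊥-elim (x≢y refl)
  drop-x []       x≢y (there p)   = p
  drop-x (c ∷ cs) x≢y (here p)    = here p
  drop-x (c ∷ cs) x≢y (there p)   = there (drop-x cs x≢y p)
  xs⊆ : ∀ {y} → y ∈ xs → y ∈ as ++ bs
  xs⊆ y∈xs = drop-x as (All.lookup x∉xs y∈xs) (xs⊆ys (there y∈xs))

indicator : Bool → ℕ
indicator b = if b then 1 else 0

indicator≤1 : ∀ b → indicator b ≤ 1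
indicator≤1 true  = ≤-refl
indicator≤1 false = z≤n

indicator≡0 : ∀ b → ¬ T b → indicator b ≡ 0
indicator≡0 true  ¬t = ⊥-elim (¬t _)
indicator≡0 false _  = refl

count : ∀ {A : Set} → List A → (A → Bool) → ℕ
count xs q = ∑ xs (indicator ∘ q)

count≤length : ∀ {A : Set} xs (q : A → Bool) → count xs q ≤ length xs
count≤length xs q =
  ≤-trans (∑-mono xs (λ {x} _ → indicator≤1 (q x))) (≤-reflexive (∑-length xs))

count≤1 : ∀ {A : Set} {xs} (q : A → Bool) →
          AllPairs (λ x y → ¬ (T (q x) × T (q y))) xs → count xs q ≤ 1
count≤1 {xs = []}     q []           = z≤n
count≤1 {xs = x ∷ xs} q (¬qxy ∷ qxs) with q x
... | false = count≤1 q qxs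
... | true  = ≤-reflexive (cong suc (none ¬qxy))
  where
  none : ∀ {ys} → All (λ y → ¬ (T true × T (q y))) ys → count ys q ≡ 0
  none []                = refl
  none (_∷_ {x = y} p ps) = cong₂ _+_ (indicator≡0 (q y) (p ∘ (_ ,_))) (none ps)

-- Random words and their weights

∈-words : ∀ {n} (w : Word n) → w ∈ words n (length w)
∈-words []      = here refl
∈-words (i ∷ w) = ∈-cartesianProductWith⁺ _∷_ (∈-allFin i) (∈-words w)

∑-words-+ : ∀ n k m (f : Word n → ℕ) →
            ∑ (words n (k + m)) f ≡ ∑ (words n k) λ u → ∑ (words n m) λ w → f (u ++ w)
∑-words-+ n zero    m f = sym (+-identityʳ _)
∑-words-+ n (suc k) m f = begin
  ∑ (words n (suc k + m)) f
    ≡⟨ ∑-cartesianProductWith _∷_ (allFin n) _ f ⟩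
  (∑ (allFin n) λ i → ∑ (words n (k + m)) λ v → f (i ∷ v))
    ≡⟨ ∑-cong (allFin n) (λ i → ∑-words-+ n k m (f ∘ (i ∷_))) ⟩
  (∑ (allFin n) λ i → ∑ (words n k) λ u → ∑ (words n m) λ w → f (i ∷ u ++ w))
    ≡⟨ ∑-cartesianProductWith _∷_ (allFin n) _ _ ⟨
  (∑ (words n (suc k)) λ u → ∑ (words n m) λ w → f (u ++ w)) ∎
  where open ≡-Reasoning

#words : ℕ → ℕ → ℕ
#words n m = length (words n m)

#words-+ : ∀ n k m → #words n (k + m) ≡ #words n k * #words n m
#words-+ n k m = begin
  #words n (k + m)                                    ≡⟨ ∑-length (words n (k + m)) ⟨
  ∑ (words n (k + m)) (const 1)                       ≡⟨ ∑-words-+ n k m (const 1) ⟩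
  ∑ (words n k) (λ _ → ∑ (words n m) (const 1))       ≡⟨ ∑-const (words n k) _ ⟩
  #words n k * ∑ (words n m) (const 1)                ≡⟨ cong (#words n k *_) (∑-length (words n m)) ⟩
  #words n k * #words n m                             ∎
  where open ≡-Reasoning

module _ {n : ℕ} (c : Fin n → ℤ) where

  weight : Word n → ℤ
  weight []      = 0ℤ
  weight (i ∷ w) = c i ℤ.+ weight w

  weight-++ : ∀ u w → weight (u ++ w) ≡ weight u ℤ.+ weight w
  weight-++ []      w = sym (ℤ.+-identityˡ _)
  weight-++ (i ∷ u) w =
    trans (cong (ℤ._+_ (c i)) (weight-++ u w)) (sym (ℤ.+-assoc (c i) _ _))

  weight-replicate : ∀ m i → weight (replicate m i) ≡ pos m ℤ.* c i
  weight-replicate zero    i = sym (ℤ.*-zeroˡ (c i))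
  weight-replicate (suc m) i =
    trans (cong (ℤ._+_ (c i)) (weight-replicate m i)) (sym (ℤ.suc-* (pos m) (c i)))

  gap : Word n → Word n → ℕ
  gap u v = ∣ weight u ℤ.- weight v ∣

  gap-++ˡ : ∀ u v w → gap (u ++ v) (u ++ w) ≡ gap v w
  gap-++ˡ u v w = cong ∣_∣ (trans (cong₂ ℤ._-_ (weight-++ u v) (weight-++ u w))
    (lemma (weight u) (weight v) (weight w)))
    where
    lemma : ∀ a b d → (a ℤ.+ b) ℤ.- (a ℤ.+ d) ≡ b ℤ.- d
    lemma = ℤSolver.solve-∀

  gap-++ʳ : ∀ u v w → gap (u ++ w) (v ++ w) ≡ gap u v
  gap-++ʳ u v w = cong ∣_∣ (trans (cong₂ ℤ._-_ (weight-++ u w) (weight-++ v w))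
    (lemma (weight w) (weight u) (weight v)))
    where
    lemma : ∀ a b d → (b ℤ.+ a) ℤ.- (d ℤ.+ a) ≡ b ℤ.- d
    lemma = ℤSolver.solve-∀

  -- Anticoncentration of the weight of a long random word

  module Anticoncentration (i j : Fin n) (ci≢cj : c i ≢ c j) (N : ℕ) where

    -- All weights occurring in the set lie in a window of length `N`. Pairwise gaps, in place of
    -- endpoints, make the notion invariant under translation and so stable under fixing a prefix.
    Thin : (Word n → Bool) → Set
    Thin q = ∀ u v → T (q u) → T (q v) → gap u v ≤ N

    thin-++ˡ : ∀ q → Thin q → ∀ u → Thin (q ∘ (u ++_))
    thin-++ˡ q q-thin u v w p p′ =
      subst (_≤ N) (gap-++ˡ u v w) (q-thin (u ++ v) (u ++ w) p p′)

    -- Density at most p/q among the words of length `m`, with denominators cleared. It is uniform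
    -- over thin sets because conditioning on a prefix changes the set.
    Bound : (m p q : ℕ) → Set
    Bound m p q = ∀ f → Thin f → count (words n m) f * q ≤ p * #words n m

    -- For each prefix of length `k`, the remainders that complete it to a member form a thin set.
    -- The bound thus holds for every prefix, hence on average.
    bound-step : ∀ m p q k → Bound m p q → Bound (k + m) p q
    bound-step m p q k bound f f-thin = begin
      count (words n (k + m)) f * q
        ≡⟨ cong (_* q) (∑-words-+ n k m (indicator ∘ f)) ⟩
      (∑ (words n k) λ u → count (words n m) (f ∘ (u ++_))) * q
        ≡⟨ ∑-*ʳ (words n k) _ q ⟨
      (∑ (words n k) λ u → count (words n m) (f ∘ (u ++_)) * q)
        ≤⟨ ∑-mono (words n k) (λ {u} _ → bound (f ∘ (u ++_)) (thin-++ˡ f f-thin u)) ⟩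
      (∑ (words n k) λ u → p * #words n m)
        ≡⟨ ∑-const (words n k) _ ⟩
      #words n k * (p * #words n m)
        ≡⟨ lemma (#words n k) p (#words n m) ⟩
      p * (#words n k * #words n m)
        ≡⟨ cong (p *_) (#words-+ n k m) ⟨
      p * #words n (k + m) ∎
      where
      open ≤-Reasoning
      lemma : ∀ a b d → a * (b * d) ≡ b * (a * d)
      lemma = ℕSolver.solve-∀

    Far : Word n → Word n → Set
    Far u v = N < gap u v

    -- Trading letters `j` for letters `i` in batches of N + 1 keeps the length at (N + 1) K, while
    -- each batch shifts the weight by N + 1 times the nonzero integer c i - c j.
    blockWord : ℕ → ℕ → Word n
    blockWord K a = replicate (suc N * a) i ++ replicate (suc N * (K ∸ a)) j

    length-blockWord : ∀ K a → a ≤ K → length (blockWord K a) ≡ suc N * K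
    length-blockWord K a a≤K = begin
      length (blockWord K a)              ≡⟨ length-++ (replicate (suc N * a) i) ⟩
      length (replicate (suc N * a) i) + length (replicate (suc N * (K ∸ a)) j)
        ≡⟨ cong₂ _+_ (length-replicate (suc N * a)) (length-replicate (suc N * (K ∸ a))) ⟩
      suc N * a + suc N * (K ∸ a)         ≡⟨ *-distribˡ-+ (suc N) a (K ∸ a) ⟨
      suc N * (a + (K ∸ a))               ≡⟨ cong (suc N *_) (m+[n∸m]≡n a≤K) ⟩
      suc N * K                           ∎
      where open ≡-Reasoning

    weight-blockWord : ∀ K a → a ≤ K →
      weight (blockWord K a) ≡ pos (suc N) ℤ.* (pos a ℤ.* (c i ℤ.- c j) ℤ.+ pos K ℤ.* c j)
    weight-blockWord K a a≤K = begin
      weight (blockWord K a)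
        ≡⟨ weight-++ (replicate (suc N * a) i) _ ⟩
      weight (replicate (suc N * a) i) ℤ.+ weight (replicate (suc N * (K ∸ a)) j)
        ≡⟨ cong₂ ℤ._+_ (weight-replicate (suc N * a) i) (weight-replicate (suc N * (K ∸ a)) j) ⟩
      pos (suc N * a) ℤ.* c i ℤ.+ pos (suc N * (K ∸ a)) ℤ.* c j
        ≡⟨ cong₂ (λ x y → x ℤ.* c i ℤ.+ y ℤ.* c j)
             (ℤ.pos-* (suc N) a) (ℤ.pos-* (suc N) (K ∸ a)) ⟩
      (pos (suc N) ℤ.* pos a) ℤ.* c i ℤ.+ (pos (suc N) ℤ.* pos (K ∸ a)) ℤ.* c j
        ≡⟨ lemma (pos (suc N)) (pos a) (pos (K ∸ a)) (c i) (c j) ⟩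
      pos (suc N) ℤ.* (pos a ℤ.* (c i ℤ.- c j) ℤ.+ (pos a ℤ.+ pos (K ∸ a)) ℤ.* c j)
        ≡⟨ cong (λ x → pos (suc N) ℤ.* (pos a ℤ.* (c i ℤ.- c j) ℤ.+ (pos x) ℤ.* c j)) (m+[n∸m]≡n a≤K) ⟩
      pos (suc N) ℤ.* (pos a ℤ.* (c i ℤ.- c j) ℤ.+ pos K ℤ.* c j) ∎
      where
      open ≡-Reasoning
      lemma : ∀ s a b x y → (s ℤ.* a) ℤ.* x ℤ.+ (s ℤ.* b) ℤ.* y ≡
                            s ℤ.* (a ℤ.* (x ℤ.- y) ℤ.+ (a ℤ.+ b) ℤ.* y)
      lemma = ℤSolver.solve-∀

    blockWord-far : ∀ K {a b} → a < b → b < K → Far (blockWord K a) (blockWord K b)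
    blockWord-far K {a} {b} a<b b<K = begin-strict
      N                    <⟨ n<1+n N ⟩
      suc N                ≤⟨ m≤m*n (suc N) _ {{ℕ.≢-nonZero d≢0}} ⟩
      suc N * ∣ d ∣        ≡⟨ ℤ.abs-* (pos (suc N)) d ⟨
      ∣ pos (suc N) ℤ.* d ∣    ≡⟨ cong ∣_∣ weight-difference ⟨
      gap (blockWord K a) (blockWord K b) ∎
      where
      open ≤-Reasoning
      d = (pos a ℤ.- pos b) ℤ.* (c i ℤ.- c j)
      d≢0 : ∣ d ∣ ≢ 0
      d≢0 d≡0 with ℤ.i*j≡0⇒i≡0∨j≡0 (pos a ℤ.- pos b) (ℤ.∣i∣≡0⇒i≡0 d≡0)
      ... | inj₁ a-b≡0   = <⇒≢ a<b (ℤ.+-injective (ℤ.i-j≡0⇒i≡j (pos a) (pos b) a-b≡0))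
      ... | inj₂ ci-cj≡0 = ci≢cj (ℤ.i-j≡0⇒i≡j (c i) (c j) ci-cj≡0)
      lemma : ∀ s a b x y → s ℤ.* (a ℤ.* x ℤ.+ y) ℤ.- s ℤ.* (b ℤ.* x ℤ.+ y) ≡
                            s ℤ.* ((a ℤ.- b) ℤ.* x)
      lemma = ℤSolver.solve-∀
      weight-difference : weight (blockWord K a) ℤ.- weight (blockWord K b) ≡ pos (suc N) ℤ.* d
      weight-difference = trans
        (cong₂ ℤ._-_ (weight-blockWord K a (<⇒≤ (<-trans a<b b<K)))
                     (weight-blockWord K b (<⇒≤ b<K)))
        (lemma (pos (suc N)) (pos a) (pos b) (c i ℤ.- c j) (pos K ℤ.* c j))

    blocks : ℕ → List (Word n)
    blocks K = applyUpTo (blockWord K) K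

    blocks-far : ∀ K → AllPairs Far (blocks K)
    blocks-far K = AllPairs.applyUpTo⁺₁ (blockWord K) K (blockWord-far K)

    gap-refl : ∀ u → gap u u ≡ 0
    gap-refl u = cong ∣_∣ (ℤ.+-inverseʳ (weight u))

    Far⇒≢ : ∀ {u v} → Far u v → u ≢ v
    Far⇒≢ {u} far refl = n≮0 (subst (N <_) (gap-refl u) far)

    #words>0 : ∀ m → 0 < #words n m
    #words>0 m = subst (λ k → 0 < #words n k) (length-replicate m {i})
      (nonempty (∈-words (replicate m i)))
      where
      nonempty : ∀ {w} {ws : List (Word n)} → w ∈ ws → 0 < length ws
      nonempty (here _)  = s≤s z≤n
      nonempty (there _) = s≤s z≤n

    -- A random prefix of length k is one of the K blocks with probability K/X.
    -- As the blocks are far apart, each remainder completes at most one of them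
    -- to a member of a thin set, so that given a block the density is at most
    -- 1/K; a bound above 2/K therefore improves by 1/X.
    bound-improve : ∀ m p K (let k = suc N * K ; X = #words n k) →
      2 * X ≤ suc p * K → Bound m (suc p) X → Bound (k + m) p X
    bound-improve m p K 2X≤pK bound f f-thin = begin
      count (words n (k + m)) f * X   ≡⟨ cong (_* X) (∑-words-+ n k m (indicator ∘ f)) ⟩
      S * X                           ≤⟨ *-monoˡ-≤ X S≤pm ⟩
      p * #words n m * X              ≡⟨ lemma p (#words n m) X ⟩
      p * (X * #words n m)            ≡⟨ cong (p *_) (#words-+ n k m) ⟨
      p * #words n (k + m)            ∎
      where
      open ≤-Reasoning
      k = suc N * K
      X = #words n k
      M = #words n m
      B = suc p * M
      W = blocks K

      F : Word n → ℕ
      F u = count (words n m) (f ∘ (u ++_))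
      S = ∑ (words n k) F

      F≤B : ∀ u → F u * X ≤ B
      F≤B u = bound (f ∘ (u ++_)) (thin-++ˡ f f-thin u)

      -- `B ∸ F u * X` is the slack in the old bound at the prefix `u`. Being nonnegative, it sums
      -- to no more over the blocks than over all prefixes; this comparison is what yields `key`.
      complement : ∀ us → ∑ us F * X + ∑ us (λ u → B ∸ F u * X) ≡ length us * B
      complement us = begin-equality
        ∑ us F * X + ∑ us (λ u → B ∸ F u * X)
          ≡⟨ cong (_+ ∑ us (λ u → B ∸ F u * X)) (∑-*ʳ us F X) ⟨
        ∑ us (λ u → F u * X) + ∑ us (λ u → B ∸ F u * X)
          ≡⟨ ∑-+ us (λ u → F u * X) (λ u → B ∸ F u * X) ⟨
        ∑ us (λ u → F u * X + (B ∸ F u * X))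
          ≡⟨ ∑-cong us (λ u → m+[n∸m]≡n (F≤B u)) ⟩
        ∑ us (const B)
          ≡⟨ ∑-const us B ⟩
        length us * B ∎

      W⊆words : ∀ {u} → u ∈ W → u ∈ words n k
      W⊆words u∈W with ∈-applyUpTo⁻ (blockWord K) u∈W
      ... | a , a<K , refl = subst (λ l → blockWord K a ∈ words n l)
        (length-blockWord K a (<⇒≤ a<K)) (∈-words (blockWord K a))

      ∑W≤M : ∑ W F ≤ M
      ∑W≤M = begin
        ∑ W F
          ≡⟨ ∑-swap W (words n m) (λ u w → indicator (f (u ++ w))) ⟩
        (∑ (words n m) λ w → count W (λ u → f (u ++ w)))
          ≤⟨ ∑-mono (words n m) (λ {w} _ → count≤1 (λ u → f (u ++ w))
               (AllPairs.map (λ {u v} far (p , q) → <⇒≱ far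
                 (subst (_≤ N) (gap-++ʳ u v w) (f-thin (u ++ w) (v ++ w) p q))) (blocks-far K))) ⟩
        ∑ (words n m) (const 1)
          ≡⟨ ∑-length (words n m) ⟩
        M ∎

      key : S * X + K * B ≤ X * B + M * X
      key = begin
        S * X + K * B
          ≡⟨ cong (λ l → S * X + l * B) (length-applyUpTo (blockWord K) K) ⟨
        S * X + length W * B
          ≡⟨ cong (S * X +_) (complement W) ⟨
        S * X + (∑ W F * X + ∑ W (λ u → B ∸ F u * X))
          ≤⟨ +-monoʳ-≤ (S * X) (+-mono-≤ (*-monoˡ-≤ X ∑W≤M)
               (∑-⊆ _ (AllPairs.map Far⇒≢ (blocks-far K)) W⊆words)) ⟩
        S * X + (M * X + ∑ (words n k) (λ u → B ∸ F u * X))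
          ≡⟨ lemma′ (S * X) (M * X) _ ⟩
        S * X + ∑ (words n k) (λ u → B ∸ F u * X) + M * X
          ≡⟨ cong (_+ M * X) (complement (words n k)) ⟩
        X * B + M * X ∎
        where
        lemma′ : ∀ a b d → a + (b + d) ≡ a + d + b
        lemma′ = ℕSolver.solve-∀

      -- By `key`, S X ≤ (B + M) X - K B with B = (p + 1) M. The hypothesis 2 X ≤ (p + 1) K gives K
      -- B ≥ 2 X M, and dividing by X leaves S ≤ p M.
      S≤pm : S ≤ p * M
      S≤pm = +-cancelʳ-≤ (2 * M) S (p * M)
        (*-cancelˡ-≤ X {{ℕ.>-nonZero (#words>0 k)}} (begin
        X * (S + 2 * M)          ≡⟨ lemma₁ X S M ⟩
        S * X + 2 * X * M        ≤⟨ +-monoʳ-≤ (S * X) (*-monoˡ-≤ M 2X≤pK) ⟩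
        S * X + suc p * K * M    ≡⟨ lemma₂ (S * X) p K M ⟩
        S * X + K * B            ≤⟨ key ⟩
        X * B + M * X            ≡⟨ lemma₃ X p M ⟩
        X * (p * M + 2 * M)      ∎))
        where
        lemma₁ : ∀ x s m → x * (s + 2 * m) ≡ s * x + 2 * x * m
        lemma₁ = ℕSolver.solve-∀
        lemma₂ : ∀ s p k m → s + suc p * k * m ≡ s + k * (suc p * m)
        lemma₂ = ℕSolver.solve-∀
        lemma₃ : ∀ x p m → x * (suc p * m) + m * x ≡ x * (p * m + 2 * m)
        lemma₃ = ℕSolver.solve-∀

      lemma : ∀ a b d → a * b * d ≡ a * (d * b)
      lemma = ℕSolver.solve-∀

    bound-weaken : ∀ m p X K → 0 < X → p * K ≤ 2 * X → Bound m p X → Bound m 2 K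
    bound-weaken m p X K X>0 pK≤2X bound f f-thin =
      *-cancelʳ-≤ _ _ X {{ℕ.>-nonZero X>0}} (begin
        c′ * K * X     ≡⟨ lemma c′ K X ⟩
        c′ * X * K     ≤⟨ *-monoˡ-≤ K (bound f f-thin) ⟩
        p * M * K      ≡⟨ lemma p M K ⟩
        p * K * M      ≤⟨ *-monoˡ-≤ M pK≤2X ⟩
        2 * X * M      ≡⟨ lemma 2 X M ⟩
        2 * M * X      ∎)
      where
      open ≤-Reasoning
      c′ = count (words n m) f
      M = #words n m
      lemma : ∀ a b d → a * b * d ≡ a * d * b
      lemma = ℕSolver.solve-∀

    -- Each improvement lowers `p` by one at the price of longer words, until p/X ≤ 2/K, where X is
    -- the number of words of length (N + 1) K. At p = 0 this inequality is trivial, so the descent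
    -- stops.
    bound-from : ∀ K p m → Bound m p (#words n (suc N * K)) → ∃[ m ] Bound m 2 K
    bound-from K p m bound with p * K ℕ.≤? 2 * #words n (suc N * K)
    ... | yes pK≤2X = m , bound-weaken m p _ K (#words>0 (suc N * K)) pK≤2X bound
    bound-from K zero    m bound | no pK≰2X = ⊥-elim (pK≰2X z≤n)
    bound-from K (suc p) m bound | no pK≰2X =
      bound-from K p (suc N * K + m) (bound-improve m p K (<⇒≤ (≰⇒> pK≰2X)) bound)

    thin-sparse : ∀ K → ∃[ m₀ ] (∀ m → m₀ ≤ m → Bound m 2 K)
    -- The descent starts from the density X/X = 1 at length 0; `bound-step` then carries the final
    -- bound to all greater lengths.
    thin-sparse K with bound-from K (#words n (suc N * K)) 0 trivial
      where
      trivial : Bound 0 (#words n (suc N * K)) (#words n (suc N * K))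
      trivial f _ = ≤-trans (*-monoˡ-≤ _ (count≤length (words n 0) f))
        (≤-reflexive (*-comm 1 _))
    ... | m₀ , bound = m₀ , λ m m₀≤m →
      subst (λ l → Bound l 2 K) (m∸n+n≡m m₀≤m) (bound-step m₀ 2 K (m ∸ m₀) bound)

-- Density of pairs of words

record Sparse {A : Set} (K : ℕ) (q : A → Bool) (xs : List A) : Set where
  constructor sparse
  field bound : count xs q * K ≤ 2 * length xs
open Sparse

sparse-concatMap : ∀ {A B : Set} K (q : B → Bool) (f : A → List B) xs →
  (∀ {x} → x ∈ xs → Sparse K q (f x)) → Sparse K q (concatMap f xs)
sparse-concatMap K q f xs f-sparse = sparse (begin
  count (concatMap f xs) q * K                  ≡⟨ cong (_* K) (∑-concatMap f xs _) ⟩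
  (∑ xs λ x → count (f x) q) * K                ≡⟨ ∑-*ʳ xs _ K ⟨
  (∑ xs λ x → count (f x) q * K)                ≤⟨ ∑-mono xs (bound ∘ f-sparse) ⟩
  (∑ xs λ x → 2 * length (f x))                 ≡⟨ ∑-cong xs (λ x → *-comm 2 (length (f x))) ⟩
  (∑ xs λ x → length (f x) * 2)                 ≡⟨ ∑-*ʳ xs _ 2 ⟩
  (∑ xs λ x → length (f x)) * 2                 ≡⟨ *-comm (∑ xs λ x → length (f x)) 2 ⟩
  2 * (∑ xs λ x → length (f x))                 ≡⟨ cong (2 *_) (∑-cong xs (λ x → ∑-length (f x))) ⟨
  2 * (∑ xs λ x → ∑ (f x) (const 1))            ≡⟨ cong (2 *_) (∑-concatMap f xs (const 1)) ⟨
  2 * ∑ (concatMap f xs) (const 1)              ≡⟨ cong (2 *_) (∑-length (concatMap f xs)) ⟩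
  2 * length (concatMap f xs)                   ∎)
  where open ≤-Reasoning

length-cartesianProduct : ∀ {A B : Set} (xs : List A) (ys : List B) →
  length (cartesianProduct xs ys) ≡ length xs * length ys
length-cartesianProduct xs ys = begin
  length (cartesianProduct xs ys)          ≡⟨ ∑-length (cartesianProduct xs ys) ⟨
  ∑ (cartesianProduct xs ys) (const 1)     ≡⟨ ∑-cartesianProductWith _,_ xs ys (const 1) ⟩
  ∑ xs (λ _ → ∑ ys (const 1))              ≡⟨ ∑-const xs _ ⟩
  length xs * ∑ ys (const 1)               ≡⟨ cong (length xs *_) (∑-length ys) ⟩
  length xs * length ys                    ∎
  where open ≡-Reasoning

sparse-×ʳ : ∀ {A B : Set} K (q : A × B → Bool) xs ys →
  (∀ x → Sparse K (λ y → q (x , y)) ys) → Sparse K q (cartesianProduct xs ys)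
sparse-×ʳ K q xs ys ys-sparse = sparse (begin
  count (cartesianProduct xs ys) q * K           ≡⟨ cong (_* K) (∑-cartesianProductWith _,_ xs ys _) ⟩
  (∑ xs λ x → count ys (λ y → q (x , y))) * K    ≡⟨ ∑-*ʳ xs _ K ⟨
  (∑ xs λ x → count ys (λ y → q (x , y)) * K)    ≤⟨ ∑-mono xs (λ {x} _ → bound (ys-sparse x)) ⟩
  (∑ xs λ x → 2 * length ys)                     ≡⟨ ∑-const xs _ ⟩
  length xs * (2 * length ys)                    ≡⟨ lemma (length xs) (length ys) ⟩
  2 * (length xs * length ys)                    ≡⟨ cong (2 *_) (length-cartesianProduct xs ys) ⟨
  2 * length (cartesianProduct xs ys)            ∎)
  where
  open ≤-Reasoning
  lemma : ∀ a b → a * (2 * b) ≡ 2 * (a * b)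
  lemma = ℕSolver.solve-∀

count-swap : ∀ {A B : Set} (q : A × B → Bool) xs ys →
  count (cartesianProduct xs ys) q ≡ count (cartesianProduct ys xs) (λ (y , x) → q (x , y))
count-swap q xs ys = begin
  count (cartesianProduct xs ys) q                      ≡⟨ ∑-cartesianProductWith _,_ xs ys _ ⟩
  (∑ xs λ x → ∑ ys λ y → indicator (q (x , y)))         ≡⟨ ∑-swap xs ys _ ⟩
  (∑ ys λ y → ∑ xs λ x → indicator (q (x , y)))         ≡⟨ ∑-cartesianProductWith _,_ ys xs _ ⟨
  count (cartesianProduct ys xs) (λ (y , x) → q (x , y)) ∎
  where open ≡-Reasoning

sparse-×ˡ : ∀ {A B : Set} K (q : A × B → Bool) xs ys →
  (∀ y → Sparse K (λ x → q (x , y)) xs) → Sparse K q (cartesianProduct xs ys)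
sparse-×ˡ K q xs ys xs-sparse = sparse (begin
  count (cartesianProduct xs ys) q * K       ≡⟨ cong (_* K) (count-swap q xs ys) ⟩
  count (cartesianProduct ys xs) (λ (y , x) → q (x , y)) * K
    ≤⟨ bound (sparse-×ʳ K (λ (y , x) → q (x , y)) ys xs xs-sparse) ⟩
  2 * length (cartesianProduct ys xs)        ≡⟨ cong (2 *_) (length-cartesianProduct ys xs) ⟩
  2 * (length ys * length xs)                ≡⟨ cong (2 *_) (*-comm (length ys) _) ⟩
  2 * (length xs * length ys)                ≡⟨ cong (2 *_) (length-cartesianProduct xs ys) ⟨
  2 * length (cartesianProduct xs ys)        ∎)
  where open ≤-Reasoning

-- Identities of bounded length, and those with a small weight difference

identities-suc : ∀ n s → identities n (suc s) ≡ identities n s ++ identitiesOfLength n (suc s)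
identities-suc n s = begin
  concatMap f (upTo (suc (suc s)))            ≡⟨ cong (concatMap f) (upTo-∷ʳ (suc s)) ⟨
  concatMap f (upTo (suc s) ++ suc s ∷ [])    ≡⟨ concatMap-++ f (upTo (suc s)) (suc s ∷ []) ⟩
  identities n s ++ (f (suc s) ++ [])         ≡⟨ cong (identities n s ++_) (++-identityʳ (f (suc s))) ⟩
  identities n s ++ f (suc s)                 ∎
  where
  open ≡-Reasoning
  f = identitiesOfLength n

P-suc : ∀ n s → P n (suc s) ≡ P n s + length (identitiesOfLength n (suc s))
P-suc n s = trans (cong length (identities-suc n s)) (length-++ (identities n s))

-- The identities equating the k-th iterate of one symbol at a with a, for k ≤ s, are already s + 1
-- in number.
P-unbounded : ∀ {n} → Fin n → ∀ s → s < P n s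
P-unbounded {n} i s = begin
  suc s                    ≡⟨ length-applyUpTo R (suc s) ⟨
  length (applyUpTo R (suc s)) ≡⟨ ∑-length (applyUpTo R (suc s)) ⟨
  ∑ (applyUpTo R (suc s)) (const 1)
    ≤⟨ ∑-⊆ (const 1) (AllPairs.applyUpTo⁺₁ R (suc s) (λ a<b _ → R-injective a<b)) R∈identities ⟩
  ∑ (identities n s) (const 1) ≡⟨ ∑-length (identities n s) ⟩
  P n s                    ∎
  where
  open ≤-Reasoning
  R : ℕ → Identity n
  R k = replicate k i , []
  R-injective : ∀ {a b} → a < b → R a ≢ R b
  R-injective {a} {b} a<b eq = <⇒≢ a<b (trans (sym (length-replicate a))
    (trans (cong (length ∘ proj₁) eq) (length-replicate b)))
  R∈identities : ∀ {r} → r ∈ applyUpTo R (suc s) → r ∈ identities n s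
  R∈identities r∈ with ∈-applyUpTo⁻ R r∈
  ... | k , s≤s k≤s , refl = ∈-identities⁺ (R k) (≤-trans
    (≤-reflexive (trans (+-identityʳ _) (length-replicate k))) k≤s)

module _ {n : ℕ} (c : Fin n → ℤ) where

  gap-sym : ∀ u v → gap c u v ≡ gap c v u
  gap-sym u v = ℤ.∣i-j∣≡∣j-i∣ (weight c u) (weight c v)

  gap-triangle : ∀ u v w → gap c u w ≤ gap c u v + gap c v w
  gap-triangle u v w = begin
    ∣ weight c u ℤ.- weight c w ∣
      ≡⟨ cong ∣_∣ (lemma (weight c u) (weight c v) (weight c w)) ⟩
    ∣ (weight c u ℤ.- weight c v) ℤ.+ (weight c v ℤ.- weight c w) ∣
      ≤⟨ ℤ.∣i+j∣≤∣i∣+∣j∣ (weight c u ℤ.- weight c v) _ ⟩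
    gap c u v + gap c v w ∎
    where
    open ≤-Reasoning
    lemma : ∀ a b d → a ℤ.- d ≡ (a ℤ.- b) ℤ.+ (b ℤ.- d)
    lemma = ℤSolver.solve-∀

  near : ℕ → Identity n → Bool
  near N (t , t′) = gap c t t′ ≤ᵇ N

  module _ (i j : Fin n) (ci≢cj : c i ≢ c j) (N : ℕ) where
    -- Two weights within `N` of a third differ by at most `N + N`.
    open Anticoncentration c i j ci≢cj (N + N)

    near-thinʳ : ∀ t → Thin (λ t′ → near N (t , t′))
    near-thinʳ t u v p p′ = ≤-trans (gap-triangle u t v) (+-mono-≤
      (≤-trans (≤-reflexive (gap-sym u t)) (≤ᵇ⇒≤ _ N p)) (≤ᵇ⇒≤ _ N p′))

    near-thinˡ : ∀ t′ → Thin (λ t → near N (t , t′))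
    near-thinˡ t′ u v p p′ = ≤-trans (gap-triangle u t′ v) (+-mono-≤ (≤ᵇ⇒≤ _ N p)
      (≤-trans (≤-reflexive (gap-sym t′ v)) (≤ᵇ⇒≤ _ N p′)))

    near-sparse : ∀ K → ∃[ L ] (∀ l → L ≤ l → Sparse K (near N) (identitiesOfLength n l))
    -- If the total length is at least twice `m₀`, one of the two words has length at least `m₀`.
    -- The other word is held fixed and the density bound is applied to the long one.
    near-sparse K = m₀ + m₀ , λ l m₀+m₀≤l →
      sparse-concatMap K (near N) (λ k → cartesianProduct (words n k) (words n (l ∸ k)))
        (upTo (suc l)) (λ {k} _ → each l m₀+m₀≤l k)
      where
      m₀ = proj₁ (thin-sparse K)
      thin = proj₂ (thin-sparse K)
      each : ∀ l → m₀ + m₀ ≤ l → ∀ k →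
             Sparse K (near N) (cartesianProduct (words n k) (words n (l ∸ k)))
      each l m₀+m₀≤l k with ≤-total m₀ k
      ... | inj₁ m₀≤k = sparse-×ˡ K (near N) (words n k) (words n (l ∸ k))
        (λ t′ → sparse (thin k m₀≤k (λ t → near N (t , t′)) (near-thinˡ t′)))
      ... | inj₂ k≤m₀ = sparse-×ʳ K (near N) (words n k) (words n (l ∸ k))
        (λ t → sparse (thin (l ∸ k) (m+n≤o⇒m≤o∸n m₀ (≤-trans (+-monoʳ-≤ m₀ k≤m₀) m₀+m₀≤l))
          (λ t′ → near N (t , t′)) (near-thinʳ t)))

    -- Every length from `L` on contributes with density at most 2/(3K), which accounts for two
    -- thirds of the allowance 1/K. The at most `P n L` identities of length up to `L` fit into the
    -- last third once s ≥ P n L * 3K, since P n s exceeds s.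
    near-negligible : ∀ K → ∃[ s₀ ] (∀ s → s₀ ≤ s → count (identities n s) (near N) * K ≤ P n s)
    near-negligible K = L + P n L * (3 * K) , λ s s₀≤s → *-cancelˡ-≤ 3 (begin
      3 * (count (identities n s) (near N) * K)
        ≡⟨ lemma (count (identities n s) (near N)) K ⟩
      count (identities n s) (near N) * (3 * K)
        ≤⟨ subst Accumulated (m∸n+n≡m (m+n≤o⇒m≤o L s₀≤s)) (accumulate (s ∸ L)) ⟩
      2 * P n s + P n L * (3 * K)
        ≤⟨ +-monoʳ-≤ (2 * P n s) (<⇒≤ (≤-<-trans (m+n≤o⇒n≤o L s₀≤s) (P-unbounded i s))) ⟩
      2 * P n s + P n s
        ≡⟨ +-comm (2 * P n s) _ ⟩
      3 * P n s ∎)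
      where
      open ≤-Reasoning
      L = proj₁ (near-sparse (3 * K))
      near-sp = proj₂ (near-sparse (3 * K))
      Accumulated : ℕ → Set
      Accumulated s = count (identities n s) (near N) * (3 * K) ≤ 2 * P n s + P n L * (3 * K)
      lemma : ∀ a b → 3 * (a * b) ≡ a * (3 * b)
      lemma = ℕSolver.solve-∀
      lemma′ : ∀ a b d → 2 * a + b + 2 * d ≡ 2 * (a + d) + b
      lemma′ = ℕSolver.solve-∀
      accumulate : ∀ d → Accumulated (d + L)
      accumulate zero    = ≤-trans
        (*-monoˡ-≤ (3 * K) (count≤length (identities n L) (near N))) (m≤n+m _ (2 * P n L))
      accumulate (suc d) = begin
        count (identities n (suc s)) (near N) * (3 * K)
          ≡⟨ cong (λ xs → count xs (near N) * (3 * K)) (identities-suc n s) ⟩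
        count (identities n s ++ new) (near N) * (3 * K)
          ≡⟨ cong (_* (3 * K)) (∑-++ (identities n s) new (indicator ∘ near N)) ⟩
        (count (identities n s) (near N) + count new (near N)) * (3 * K)
          ≡⟨ *-distribʳ-+ (3 * K) (count (identities n s) (near N)) _ ⟩
        count (identities n s) (near N) * (3 * K) + count new (near N) * (3 * K)
          ≤⟨ +-mono-≤ (accumulate d) (bound (near-sp (suc s) (≤-trans (m≤n+m L d) (n≤1+n s)))) ⟩
        2 * P n s + P n L * (3 * K) + 2 * length new
          ≡⟨ lemma′ (P n s) (P n L * (3 * K)) (length new) ⟩
        2 * (P n s + length new) + P n L * (3 * K)
          ≡⟨ cong (λ x → 2 * x + P n L * (3 * K)) (P-suc n s) ⟨
        2 * P n (suc s) + P n L * (3 * K) ∎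
        where
        s = d + L
        new = identitiesOfLength n (suc s)

-- Linear forms vanishing on a submodule of ℤⁿ

ℤ^ : ℕ → Set
ℤ^ n = Fin n → ℤ

dot : ∀ {n} → ℤ^ n → ℤ^ n → ℤ
dot {zero}  c x = 0ℤ
dot {suc n} c x = c zero ℤ.* x zero ℤ.+ dot (c ∘ suc) (x ∘ suc)

dot-zeroˡ : ∀ {n} (x : ℤ^ n) → dot (const 0ℤ) x ≡ 0ℤ
dot-zeroˡ {zero}  x = refl
dot-zeroˡ {suc n} x = cong₂ ℤ._+_ (ℤ.*-zeroˡ (x zero)) (dot-zeroˡ (x ∘ suc))

dot-*ˡ : ∀ {n} p (c x : ℤ^ n) → dot (λ i → p ℤ.* c i) x ≡ p ℤ.* dot c x
dot-*ˡ {zero}  p c x = sym (ℤ.*-zeroʳ p)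
dot-*ˡ {suc n} p c x = trans (cong (ℤ._+_ ((p ℤ.* c zero) ℤ.* x zero)) (dot-*ˡ p (c ∘ suc) (x ∘ suc)))
  (lemma p (c zero) (x zero) (dot (c ∘ suc) (x ∘ suc)))
  where
  lemma : ∀ p a b d → (p ℤ.* a) ℤ.* b ℤ.+ p ℤ.* d ≡ p ℤ.* (a ℤ.* b ℤ.+ d)
  lemma = ℤSolver.solve-∀

_IsCombination_·_-_·_ : ∀ {n} → ℤ^ n → ℤ → ℤ^ n → ℤ → ℤ^ n → Set
z IsCombination p · x - q · y = ∀ i → z i ≡ p ℤ.* x i ℤ.- q ℤ.* y i

zero-combination : ∀ p q → p ℤ.* 0ℤ ℤ.- q ℤ.* 0ℤ ≡ 0ℤ
zero-combination = ℤSolver.solve-∀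

dot-combination : ∀ {n} (c : ℤ^ n) p q {x y z : ℤ^ n} → z IsCombination p · x - q · y →
                  dot c z ≡ p ℤ.* dot c x ℤ.- q ℤ.* dot c y
dot-combination {zero}  c p q eq = sym (zero-combination p q)
dot-combination {suc n} c p q {x} {y} {z} eq = trans
  (cong₂ (λ a b → c zero ℤ.* a ℤ.+ b) (eq zero) (dot-combination (c ∘ suc) p q (eq ∘ suc)))
  (lemma p q (c zero) (x zero) (y zero) (dot (c ∘ suc) (x ∘ suc)) (dot (c ∘ suc) (y ∘ suc)))
  where
  lemma : ∀ p q c a b u v → c ℤ.* (p ℤ.* a ℤ.- q ℤ.* b) ℤ.+ (p ℤ.* u ℤ.- q ℤ.* v) ≡
                            p ℤ.* (c ℤ.* a ℤ.+ u) ℤ.- q ℤ.* (c ℤ.* b ℤ.+ v)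
  lemma = ℤSolver.solve-∀

-- Letting z be any vector pointwise equal to the combination also makes the submodule respect
-- pointwise equality: take p = 1 and q = 0.
IsSubmodule : ∀ {n} → (ℤ^ n → Set₁) → Set₁
IsSubmodule Λ = ∀ p q {x y z} → Λ x → Λ y → z IsCombination p · x - q · y → Λ z

-- Gaussian elimination: a relation with nonzero first coordinate p serves to
-- clear the first coordinates of b and of all other relations, at the
-- price of multiplication by p.
separate : ExcludedMiddle (lsuc 0ℓ) → ∀ {n} (Λ : ℤ^ n → Set₁) → IsSubmodule Λ → ∀ b →
  (∀ k x → k ≢ 0ℤ → Λ x → ¬ (∀ i → x i ≡ k ℤ.* b i)) →
  (∀ x → (∀ i → x i ≡ 0ℤ) → Λ x) →
  ∃[ c ] (∀ x → Λ x → dot c x ≡ 0ℤ) × dot c b ≢ 0ℤ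
separate em {zero}  Λ Λ-sub b b-free Λ-zero =
  -- In dimension zero every vector is zero, so `b` itself would be a relation.
  ⊥-elim (b-free 1ℤ (λ ()) (λ ()) (Λ-zero _ (λ ())) (λ ()))
separate em {suc n} Λ Λ-sub b b-free Λ-zero with em {∃[ x ] Λ x × x zero ≢ 0ℤ}
... | yes (l , Λl , p≢0) = c , c⊥Λ , c·b≢0
  where
  p = l zero
  Λ′ : ℤ^ n → Set₁
  Λ′ y = Λ (0ℤ Vector.∷ y)
  Λ′-sub : IsSubmodule Λ′
  Λ′-sub q r Λx Λy eq = Λ-sub q r Λx Λy λ
    { zero    → sym (zero-combination q r)
    ; (suc i) → eq i }
  clear : ℤ^ (suc n) → ℤ^ n
  clear x i = p ℤ.* x (suc i) ℤ.- x zero ℤ.* l (suc i)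
  clear-combination : ∀ x → (0ℤ Vector.∷ clear x) IsCombination p · x - x zero · l
  clear-combination x zero    = sym (lemma p (x zero))
    where
    lemma : ∀ p q → p ℤ.* q ℤ.- q ℤ.* p ≡ 0ℤ
    lemma = ℤSolver.solve-∀
  clear-combination x (suc i) = refl
  -- `clear b` is p b - b₀ l without its first coordinate, so adding k b₀ times `l` to k times
  -- `clear b` gives (k p) b, a nonzero multiple of `b` in `Λ`.
  clear-free : ∀ k y → k ≢ 0ℤ → Λ′ y → ¬ (∀ i → y i ≡ k ℤ.* clear b i)
  clear-free k y k≢0 Λy y≡kb = b-free (k ℤ.* p) (λ i → (k ℤ.* p) ℤ.* b i) kp≢0
    (Λ-sub 1ℤ (ℤ.- (k ℤ.* b zero)) Λy Λl λ
      { zero    → lemma₀ k p (b zero)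
      ; (suc i) → sym (trans (cong (λ x → 1ℤ ℤ.* x ℤ.- (ℤ.- (k ℤ.* b zero)) ℤ.* l (suc i)) (y≡kb i))
                   (lemma₁ k p (b zero) (b (suc i)) (l (suc i)))) })
    (λ _ → refl)
    where
    kp≢0 : k ℤ.* p ≢ 0ℤ
    kp≢0 kp≡0 with ℤ.i*j≡0⇒i≡0∨j≡0 k kp≡0
    ... | inj₁ k≡0 = k≢0 k≡0
    ... | inj₂ p≡0 = p≢0 p≡0
    lemma₀ : ∀ k p b → (k ℤ.* p) ℤ.* b ≡ 1ℤ ℤ.* 0ℤ ℤ.- (ℤ.- (k ℤ.* b)) ℤ.* p
    lemma₀ = ℤSolver.solve-∀
    lemma₁ : ∀ k p b b′ l → 1ℤ ℤ.* (k ℤ.* (p ℤ.* b′ ℤ.- b ℤ.* l)) ℤ.- (ℤ.- (k ℤ.* b)) ℤ.* l ≡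
                            (k ℤ.* p) ℤ.* b′
    lemma₁ = ℤSolver.solve-∀
  rec = separate em Λ′ Λ′-sub (clear b) clear-free
    (λ y y≡0 → Λ-zero _ λ { zero → refl ; (suc i) → y≡0 i })
  c′ = proj₁ rec
  -- The first coordinate is chosen so that evaluating `c` at x amounts to evaluating `c′` at
  -- `clear x`; in particular `c` kills `l`.
  c : ℤ^ (suc n)
  c = (ℤ.- dot c′ (l ∘ suc)) Vector.∷ (λ i → p ℤ.* c′ i)
  dot-c : ∀ x → dot c x ≡ dot c′ (clear x)
  dot-c x = begin
    (ℤ.- dot c′ (l ∘ suc)) ℤ.* x zero ℤ.+ dot (λ i → p ℤ.* c′ i) (x ∘ suc)
      ≡⟨ cong (ℤ._+_ ((ℤ.- dot c′ (l ∘ suc)) ℤ.* x zero)) (dot-*ˡ p c′ (x ∘ suc)) ⟩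
    (ℤ.- dot c′ (l ∘ suc)) ℤ.* x zero ℤ.+ p ℤ.* dot c′ (x ∘ suc)
      ≡⟨ lemma (dot c′ (l ∘ suc)) (x zero) p (dot c′ (x ∘ suc)) ⟩
    p ℤ.* dot c′ (x ∘ suc) ℤ.- x zero ℤ.* dot c′ (l ∘ suc)
      ≡⟨ dot-combination c′ p (x zero) (λ _ → refl) ⟨
    dot c′ (clear x) ∎
    where
    open ≡-Reasoning
    lemma : ∀ a b p d → (ℤ.- a) ℤ.* b ℤ.+ p ℤ.* d ≡ p ℤ.* d ℤ.- b ℤ.* a
    lemma = ℤSolver.solve-∀
  c⊥Λ : ∀ x → Λ x → dot c x ≡ 0ℤ
  c⊥Λ x Λx = trans (dot-c x) (proj₁ (proj₂ rec) (clear x)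
    (Λ-sub p (x zero) Λx Λl (clear-combination x)))
  c·b≢0 : dot c b ≢ 0ℤ
  c·b≢0 eq = proj₂ (proj₂ rec) (trans (sym (dot-c b)) eq)
... | no ¬l with b zero ℤ.≟ 0ℤ
-- All relations have first coordinate zero and `b` has not, so the first coordinate function
-- separates them.
... | no b₀≢0 = c , c⊥Λ , λ c·b≡0 → b₀≢0 (trans (sym (dot-c b)) c·b≡0)
  where
  c : ℤ^ (suc n)
  c = 1ℤ Vector.∷ const 0ℤ
  dot-c : ∀ x → dot c x ≡ x zero
  dot-c x = trans (cong (ℤ._+_ (1ℤ ℤ.* x zero)) (dot-zeroˡ (x ∘ suc)))
    (trans (ℤ.+-identityʳ _) (ℤ.*-identityˡ (x zero)))
  c⊥Λ : ∀ x → Λ x → dot c x ≡ 0ℤ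
  c⊥Λ x Λx = trans (dot-c x) (decidable-stable (x zero ℤ.≟ 0ℤ) (λ x₀≢0 → ¬l (x , Λx , x₀≢0)))
... | yes b₀≡0 = c , c⊥Λ , λ c·b≡0 → proj₂ (proj₂ rec) (trans (sym (dot-c b)) c·b≡0)
  where
  Λ′ : ℤ^ n → Set₁
  Λ′ y = Λ (0ℤ Vector.∷ y)
  rec = separate em Λ′
    (λ q r Λx Λy eq → Λ-sub q r Λx Λy λ { zero → sym (zero-combination q r) ; (suc i) → eq i })
    (b ∘ suc)
    (λ k y k≢0 Λy y≡kb → b-free k _ k≢0 Λy λ
      { zero    → sym (trans (cong (k ℤ.*_) b₀≡0) (ℤ.*-zeroʳ k))
      ; (suc i) → y≡kb i })
    (λ y y≡0 → Λ-zero _ λ { zero → refl ; (suc i) → y≡0 i })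
  c : ℤ^ (suc n)
  c = 0ℤ Vector.∷ proj₁ rec
  dot-c : ∀ x → dot c x ≡ dot (proj₁ rec) (x ∘ suc)
  dot-c x = trans (cong (λ a → a ℤ.+ dot (proj₁ rec) (x ∘ suc)) (ℤ.*-zeroˡ (x zero))) (ℤ.+-identityˡ _)
  c⊥Λ : ∀ x → Λ x → dot c x ≡ 0ℤ
  c⊥Λ x Λx = trans (dot-c x) (proj₁ (proj₂ rec) (x ∘ suc)
    (Λ-sub 1ℤ 0ℤ Λx Λx λ
      { zero    → trans (sym x₀≡0) (lemma (x zero))
      ; (suc i) → lemma (x (suc i)) }))
    where
    x₀≡0 : x zero ≡ 0ℤ
    x₀≡0 = decidable-stable (x zero ℤ.≟ 0ℤ) (λ x₀≢0 → ¬l (x , Λx , x₀≢0))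
    lemma : ∀ a → a ≡ 1ℤ ℤ.* a ℤ.- 0ℤ ℤ.* a
    lemma = ℤSolver.solve-∀

-- Presented structures

module Quotient (em : ExcludedMiddle (lsuc 0ℓ)) {n : ℕ} (E : Axioms n)
  (_~_ : Word n → Word n → Set₁) (~-isEquivalence : IsEquivalence _~_)
  (~-cong : ∀ i u v → u ~ v → (i ∷ u) ~ (i ∷ v))
  (~-coarse : ∀ u v → Follows E ∅ u v → u ~ v) where

  private module ~ = IsEquivalence ~-isEquivalence

  -- Excluded middle brings the relation down to the universe level of the
  -- models over which Follows quantifies.
  quotient : Structure n 0ℓ 0ℓ
  quotient = record
    { Carrier       = Word n
    ; _≈_           = λ u v → True (em {u ~ v})
    ; isEquivalence = record
      { refl  = fromWitness ~.refl
      ; sym   = λ p → fromWitness (~.sym (toWitness p))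
      ; trans = λ p q → fromWitness (~.trans (toWitness p) (toWitness q))
      }
    ; op            = _∷_
    ; op-cong       = λ i {u v} p → fromWitness (~-cong i u v (toWitness p))
    ; inhabitant    = []
    }

  quotient∈Variety : quotient ∈Variety E
  quotient∈Variety {t} {u} e ρ = fromWitness (~-coarse _ _ (Presented∈Variety E ∅ {t} {u} e ρ))

  -- The quotient is a member of the variety in which the identities of `S` hold at the generator
  -- `[]`, so each of their consequences can be read off there.
  follows⇒~ : ∀ {S u v} → (∀ {l r} → S (l , r) → l ~ r) → Follows E S u v → u ~ v
  follows⇒~ {S} {u} {v} S⊆~ f = toWitness (subst₂ (λ x y → True (em {x ~ y})) (act-[] u) (act-[] v)
    (f quotient quotient∈Variety [] λ {l} {r} s →
      subst₂ (λ x y → True (em {x ~ y})) (sym (act-[] l)) (sym (act-[] r)) (fromWitness (S⊆~ s))))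
    where
    act-[] : ∀ w → Structure.act quotient w [] ≡ w
    act-[] w = sym (id-is-foldr w)

-- Presented structures as abelian groups under concatenation of words

module Relations (em : ExcludedMiddle (lsuc 0ℓ)) {n : ℕ} (E : Axioms n)
  (bijective : GeneralizedBijective E) (commutative : Commutative E) where

  infix 4 _≈[_]_
  -- `Follows` unfolds to a function type, from which the words and the set of identities cannot be
  -- recovered by unification. The record keeps them visible.
  record _≈[_]_ (u : Word n) (S : Pred (Identity n) 0ℓ) (v : Word n) : Set₁ where
    constructor entail
    field follows : Follows E S u v
  open _≈[_]_ public

  module _ {S : Pred (Identity n) 0ℓ} where
    open Structure (Presented E S) using (isEquivalence; op-cong)
    private module ≋ = IsEquivalence isEquivalence

    ≈-isEquivalence : IsEquivalence (_≈[ S ]_)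
    ≈-isEquivalence = record
      { refl  = λ {u} → entail (≋.refl {u})
      ; sym   = λ {u v} p → entail (≋.sym {u} {v} (follows p))
      ; trans = λ {u v w} p q → entail (≋.trans {u} {v} {w} (follows p) (follows q))
      }

    open IsEquivalence ≈-isEquivalence using (reflexive) renaming
      (refl to ≈-refl; sym to ≈-sym; trans to ≈-trans) public

    ∷-cong : ∀ i {u v} → u ≈[ S ] v → i ∷ u ≈[ S ] i ∷ v
    ∷-cong i {u} {v} p = entail (op-cong i {u} {v} (follows p))

    ∷-cancel : ∀ i {u v} → i ∷ u ≈[ S ] i ∷ v → u ≈[ S ] v
    ∷-cancel i p = entail λ M M∈V a s →
      lower (proj₁ (bijective i) M M∈V _ _ (lift (follows p M M∈V a s)))

    ∷-comm : ∀ i j w → i ∷ j ∷ w ≈[ S ] j ∷ i ∷ w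
    ∷-comm i j w = entail λ M M∈V a s → lower (commutative i j M M∈V _)

    free⇒ : ∀ {u v} → u ≈[ ∅ ] v → u ≈[ S ] v
    free⇒ p = entail λ M M∈V a _ → follows p M M∈V a (λ ())

    ++-congˡ : ∀ w {u v} → u ≈[ S ] v → w ++ u ≈[ S ] w ++ v
    ++-congˡ []      p = p
    ++-congˡ (i ∷ w) p = ∷-cong i (++-congˡ w p)

    ++-cancelˡ-≈ : ∀ w {u v} → w ++ u ≈[ S ] w ++ v → u ≈[ S ] v
    ++-cancelˡ-≈ []      p = p
    ++-cancelˡ-≈ (i ∷ w) p = ++-cancelˡ-≈ w (∷-cancel i p)

    ++-comm : ∀ u v → u ++ v ≈[ S ] v ++ u
    ++-comm []      v = reflexive (sym (++-identityʳ v))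
    ++-comm (i ∷ u) v = ≈-trans (∷-cong i (++-comm u v)) (shift v)
      where
      shift : ∀ v → i ∷ v ++ u ≈[ S ] v ++ i ∷ u
      shift []      = ≈-refl
      shift (j ∷ v) = ≈-trans (∷-comm i j (v ++ u)) (∷-cong j (shift v))

    ++-cong : ∀ {u u′ v v′} → u ≈[ S ] u′ → v ≈[ S ] v′ → u ++ v ≈[ S ] u′ ++ v′
    ++-cong {u} {u′} {v} {v′} p q = ≈-trans (++-comm u v) (≈-trans (++-congˡ v p)
      (≈-trans (++-comm v u′) (++-congˡ u′ q)))

  commutativeMonoid : Pred (Identity n) 0ℓ → CommutativeMonoid 0ℓ (lsuc 0ℓ)
  commutativeMonoid S = record
    { Carrier = Word n
    ; _≈_ = _≈[ S ]_
    ; _∙_ = _++_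
    ; ε = []
    ; isCommutativeMonoid = record
      { isMonoid = record
        { isSemigroup = record
          { isMagma = record { isEquivalence = ≈-isEquivalence ; ∙-cong = ++-cong }
          ; assoc = λ u v w → reflexive (++-assoc u v w)
          }
        ; identity = (λ _ → ≈-refl) , (λ u → reflexive (++-identityʳ u))
        }
      ; comm = ++-comm
      }
    }

  module _ {S : Pred (Identity n) 0ℓ} where
    open CommutativeMonoid (commutativeMonoid S) using (commutativeSemigroup)
    open CommutativeSemigroupProperties commutativeSemigroup
      using (interchange; x∙yz≈y∙xz) public
    module S-Reasoning = ≈-Reasoning (CommutativeMonoid.setoid (commutativeMonoid S))

  private
    free-cong : ∀ i u v → u ≈[ ∅ ] v → i ∷ u ≈[ ∅ ] i ∷ v
    free-cong i u v = ∷-cong i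
    free-coarse : ∀ u v → Follows E ∅ u v → u ≈[ ∅ ] v
    free-coarse u v = entail
    module Free₀ = Quotient em E (_≈[ ∅ ]_) ≈-isEquivalence free-cong free-coarse

  -- Surjectivity is given for models with equality in the lowest universe, so it is applied to the
  -- copy `Free₀.quotient` of the free structure. A preimage of the generator `[]` under the letter
  -- is its inverse.
  inverseLetter : ∀ i → ∃[ w ] i ∷ w ≈[ ∅ ] []
  inverseLetter i with proj₂ (bijective i) Free₀.quotient (λ {t} {u} → Free₀.quotient∈Variety {t} {u}) []
  ... | w , p = w , toWitness (lower p)

  _⁻¹ : Word n → Word n
  []      ⁻¹ = []
  (i ∷ w) ⁻¹ = proj₁ (inverseLetter i) ++ w ⁻¹

  ⁻¹-inverse : ∀ {S} w → w ++ w ⁻¹ ≈[ S ] []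
  ⁻¹-inverse []      = ≈-refl
  ⁻¹-inverse (i ∷ w) = ≈-trans (interchange (i ∷ []) w (proj₁ (inverseLetter i)) (w ⁻¹))
    (++-cong (free⇒ (proj₂ (inverseLetter i))) (⁻¹-inverse w))

  -- Back-and-forth between presented structures

  module Games (infinite : Infinite (Free E)) where

    Faithful : ℕ → Pred (Identity n) 0ℓ → Set₁
    Faithful r S = ∀ u v → identityLength (u , v) ≤ r → u ≈[ S ] v → u ≈[ ∅ ] v

    Distinct : ∀ {N} → (Fin N → Word n) → Set₁
    Distinct f = ∀ a b → a Fin.< b → ¬ (f a ≈[ ∅ ] f b)

    distinctWords : ∀ N → ∃[ f ] Distinct {N} f
    distinctWords zero    = (λ ()) , λ ()
    distinctWords (suc N) with distinctWords N
    ... | f , f-distinct with em {∃[ w ] (∀ b → ¬ (w ≈[ ∅ ] f b))}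
    ... | yes (w , w-new) = w Vector.∷ f , λ
      { zero    (suc b) _         → w-new b
      ; (suc a) (suc b) (s≤s a<b) → f-distinct a b a<b }
    ... | no  ¬new = ⊥-elim (infinite (tabulate f , λ w → listed w))
      where
      listed : ∀ w → Any.Any (Follows E ∅ w) (tabulate f)
      listed w with em {∃[ b ] w ≈[ ∅ ] f b}
      ... | yes (b , p) = Any.tabulate⁺ b (follows p)
      ... | no  ¬p      = ⊥-elim (¬new (w , λ b p → ¬p (b , p)))

    bounded : ∀ {N} (f : Fin N → ℕ) → ∃[ r ] (∀ a → f a ≤ r)
    bounded {zero}  f = 0 , λ ()
    bounded {suc N} f with bounded (f ∘ suc)
    ... | r , f≤r = f zero ⊔ r , λ
      { zero    → m≤m⊔n _ _
      ; (suc a) → ≤-trans (f≤r a) (m≤n⊔m (f zero) r) }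

    Transfers : ∀ {m} → ℕ → (S T : Pred (Identity n) 0ℓ) (ρ σ : Fin m → Word n) → Set₁
    Transfers r S T ρ σ = ∀ i j u v → identityLength (u , v) ≤ r →
      u ++ ρ i ≈[ S ] v ++ ρ j → u ++ σ i ≈[ T ] v ++ σ j

    record Close {m} (r : ℕ) (S : Pred (Identity n) 0ℓ) (ρ : Fin m → Word n) (x : Word n) : Set₁ where
      constructor close
      field
        i     : Fin m
        u v   : Word n
        short : identityLength (u , v) ≤ r
        joins : u ++ x ≈[ S ] v ++ ρ i

    -- An element close to `σ` is determined in the presented structure by an index and a short pair
    -- of words, so there are at most as many as `codes`. Among one more freely distinct words one
    -- must be far: if two shared a code they would be identified, which faithfulness at `R + R`
    -- excludes. The radius depends on neither `S` nor `σ`.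
    farElement : ∀ m r → ∃[ r′ ] (∀ S → Faithful r′ S → ∀ (σ : Fin m → Word n) → ∃[ y ] ¬ Close r S σ y)
    farElement m r = R + R , pick
      where
      codes = cartesianProduct (allFin m) (identities n r)
      f = proj₁ (distinctWords (suc (length codes)))
      R = proj₁ (bounded (length ∘ f))
      pick : ∀ S → Faithful (R + R) S → ∀ (σ : Fin m → Word n) → ∃[ y ] ¬ Close r S σ y
      pick S S-faithful σ with em {∃[ y ] ¬ Close r S σ y}
      ... | yes y   = y
      ... | no  ¬y = ⊥-elim contra
        where
        closeAt : ∀ a → Close r S σ (f a)
        closeAt a with em {Close r S σ (f a)}
        ... | yes c  = c
        ... | no  ¬c = ⊥-elim (¬y (f a , ¬c))
        code : ∀ {x} → Close r S σ x → Fin m × Identity n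
        code (close i u v _ _) = i , u , v
        code∈ : ∀ {x} (c : Close r S σ x) → code c ∈ codes
        code∈ (close i u v short _) = ∈-cartesianProduct⁺ (∈-allFin i) (∈-identities⁺ (u , v) short)
        same-code : ∀ {x y} (c : Close r S σ x) (d : Close r S σ y) → code c ≡ code d → x ≈[ S ] y
        same-code (close i u v _ p) (close _ _ _ _ q) refl = ++-cancelˡ-≈ u (≈-trans p (≈-sym q))
        collision = pigeonhole (n<1+n (length codes)) (λ a → index (code∈ (closeAt a)))
        contra : ⊥
        contra = let a , b , a<b , eq = collision in
          proj₂ (distinctWords (suc (length codes))) a b a<b (S-faithful (f a) (f b)
            (+-mono-≤ (proj₂ (bounded (length ∘ f)) a) (proj₂ (bounded (length ∘ f)) b))
            (same-code (closeAt a) (closeAt b)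
              (trans (Any.lookup-index (code∈ (closeAt a)))
                (trans (cong (lookup codes) eq) (sym (Any.lookup-index (code∈ (closeAt b))))))))

    -- Cancelling x leaves a short identity, which by faithfulness is already free and so holds in
    -- every presented structure.
    faithful⇒≈ : ∀ {r S T} → Faithful r S → ∀ x y u v → identityLength (u , v) ≤ r →
                 u ++ x ≈[ S ] v ++ x → u ++ y ≈[ T ] v ++ y
    faithful⇒≈ S-faithful x y u v short p = ++-cong (free⇒ (S-faithful u v short
      (++-cancelˡ-≈ x (≈-trans (++-comm x u) (≈-trans p (++-comm v x)))))) ≈-refl

    -- The new points x and y have the same displacement from the i-th old points. An equation
    -- between x and an old point thus becomes one between two old points, whose words have total
    -- length at most `r + r`.
    transfers-close : ∀ {m r S T} {ρ σ : Fin m → Word n} {x y i u v} →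
      Faithful r S → identityLength (u , v) ≤ r →
      u ++ x ≈[ S ] v ++ ρ i → u ++ y ≈[ T ] v ++ σ i →
      Transfers (r + r) S T ρ σ → Transfers r S T (x Vector.∷ ρ) (y Vector.∷ σ)
    transfers-close {m} {r} {S} {T} {ρ} {σ} {x} {y} {i} {u} {v} S-faithful uv-short p q transfers = go
      where
      with-new : ∀ k w w′ → identityLength (w , w′) ≤ r → w ++ x ≈[ S ] w′ ++ ρ k → w ++ y ≈[ T ] w′ ++ σ k
      with-new k w w′ short e = ++-cancelˡ-≈ u (begin
        u ++ (w ++ y)      ≈⟨ x∙yz≈y∙xz u w y ⟩
        w ++ (u ++ y)      ≈⟨ ++-congˡ w q ⟩
        w ++ (v ++ σ i)    ≡⟨ ++-assoc w v (σ i) ⟨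
        (w ++ v) ++ σ i    ≈⟨ transfers i k (w ++ v) (u ++ w′) short′ moved ⟩
        (u ++ w′) ++ σ k   ≡⟨ ++-assoc u w′ (σ k) ⟩
        u ++ (w′ ++ σ k)   ∎)
        where
        open S-Reasoning {T}
        short′ : identityLength (w ++ v , u ++ w′) ≤ r + r
        short′ = ≤-trans (≤-reflexive (trans (cong₂ _+_ (length-++ w) (length-++ u))
          (lemma (length w) (length v) (length u) (length w′)))) (+-mono-≤ short uv-short)
          where
          lemma : ∀ a b c d → (a + b) + (c + d) ≡ (a + d) + (c + b)
          lemma = ℕSolver.solve-∀
        moved : (w ++ v) ++ ρ i ≈[ S ] (u ++ w′) ++ ρ k
        moved = ≈-trans (reflexive (++-assoc w v (ρ i))) (≈-trans (++-congˡ w (≈-sym p))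
          (≈-trans (x∙yz≈y∙xz w u x) (≈-trans (++-congˡ u e) (reflexive (sym (++-assoc u w′ (ρ k)))))))
      go : Transfers r S T (x Vector.∷ ρ) (y Vector.∷ σ)
      go zero    zero    w w′ short e = faithful⇒≈ S-faithful x y w w′ short e
      go zero    (suc k) w w′ short e = with-new k w w′ short e
      go (suc k) zero    w w′ short e = ≈-sym (with-new k w′ w
        (≤-trans (≤-reflexive (+-comm (length w′) (length w))) short) (≈-sym e))
      go (suc k) (suc l) w w′ short e = transfers k l w w′ (≤-trans short (m≤m+n r r)) e

    -- No short equation joins x to an old point, so only equations among old points, or of x with
    -- itself, have to be carried over.
    transfers-far : ∀ {m r S T} {ρ σ : Fin m → Word n} {x y} →
      Faithful r S → ¬ Close r S ρ x →
      Transfers r S T ρ σ → Transfers r S T (x Vector.∷ ρ) (y Vector.∷ σ)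
    transfers-far S-faithful far transfers zero    zero    w w′ short e =
      faithful⇒≈ S-faithful _ _ w w′ short e
    transfers-far S-faithful far transfers zero    (suc k) w w′ short e =
      ⊥-elim (far (close k w w′ short e))
    transfers-far S-faithful far transfers (suc k) zero    w w′ short e =
      ⊥-elim (far (close k w′ w (≤-trans (≤-reflexive (+-comm (length w′) (length w))) short) (≈-sym e)))
    transfers-far S-faithful far transfers (suc k) (suc l) w w′ short e = transfers k l w w′ short e

    -- Keeping both directions makes the relation symmetric, which implications and universal
    -- quantifiers call for.
    record Similar {m} (r : ℕ) (S T : Pred (Identity n) 0ℓ) (ρ σ : Fin m → Word n) : Set₁ where
      constructor similar
      field
        faithfulˡ : Faithful r S
        faithfulʳ : Faithful r T
        forth     : Transfers r S T ρ σ
        back      : Transfers r T S σ ρ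
    open Similar

    similar-sym : ∀ {m r S T} {ρ σ : Fin m → Word n} → Similar r S T ρ σ → Similar r T S σ ρ
    similar-sym (similar f f′ t t′) = similar f′ f t′ t

    similar-≤ : ∀ {m r r′ S T} {ρ σ : Fin m → Word n} → r ≤ r′ → Similar r′ S T ρ σ → Similar r S T ρ σ
    similar-≤ r≤r′ (similar f f′ t t′) = similar
      (λ u v short → f u v (≤-trans short r≤r′)) (λ u v short → f′ u v (≤-trans short r≤r′))
      (λ i j u v short → t i j u v (≤-trans short r≤r′))
      (λ i j u v short → t′ i j u v (≤-trans short r≤r′))

    extend : ∀ m r → ∃[ r′ ] (∀ {S T} {ρ σ : Fin m → Word n} → Similar r′ S T ρ σ →
             ∀ x → ∃[ y ] Similar r S T (x Vector.∷ ρ) (y Vector.∷ σ))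
    -- `r + r` serves the case of a close x, and `R` supplies a far answer to a far x.
    extend m r = (r + r) ⊔ R , go
      where
      R = proj₁ (farElement m r)
      go : ∀ {S T} {ρ σ : Fin m → Word n} → Similar ((r + r) ⊔ R) S T ρ σ →
           ∀ x → ∃[ y ] Similar r S T (x Vector.∷ ρ) (y Vector.∷ σ)
      go {S} {T} {ρ} {σ} sim x with em {Close r S ρ x}
      ... | yes (close i u v short p) = y , similar (faithfulˡ sim₁) (faithfulʳ sim₁)
        (transfers-close (faithfulˡ sim₁) short p q (forth sim₂))
        (transfers-close (faithfulʳ sim₁) short q p (back sim₂))
        where
        sim₂ = similar-≤ (m≤m⊔n (r + r) R) sim
        sim₁ = similar-≤ (m≤m+n r r) sim₂
        -- The solution of u + y = v + σ i in the group of `T`.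
        y = u ⁻¹ ++ (v ++ σ i)
        q : u ++ y ≈[ T ] v ++ σ i
        q = ≈-trans (reflexive (sym (++-assoc u (u ⁻¹) (v ++ σ i)))) (++-cong (⁻¹-inverse u) ≈-refl)
      ... | no  far = proj₁ far-y , similar (faithfulˡ sim₁) (faithfulʳ sim₁)
        (transfers-far (faithfulˡ sim₁) far (forth sim₁))
        (transfers-far (faithfulʳ sim₁) (proj₂ far-y) (back sim₁))
        where
        sim₁ = similar-≤ (≤-trans (m≤m+n r r) (m≤m⊔n (r + r) R)) sim
        far-y = proj₂ (farElement m r) T (faithfulʳ (similar-≤ (m≤n⊔m (r + r) R) sim)) σ

    Preserved : ∀ {m} → Formula n m → ℕ → Set₁
    Preserved φ r = ∀ {S T ρ σ} → Similar r S T ρ σ → Sat (Presented E S) φ ρ → Sat (Presented E T) φ σ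

    -- The radius is computed from the formula alone: it is the length of an atomic equation, a
    -- maximum at connectives, and is enlarged by `extend` at each quantifier.
    preserve : ∀ {m} (φ : Formula n m) → ∃[ r ] Preserved φ r
    preserve ⊥′ = 0 , λ _ ()
    preserve (w · i ≐ w′ · j) = identityLength (w , w′) , λ {S} {T} {ρ} {σ} sim (lift p) →
      lift (subst₂ (Follows E T) (++-is-foldr w (σ i)) (++-is-foldr w′ (σ j))
        (follows (forth sim i j w w′ ≤-refl (entail
          (subst₂ (Follows E S) (sym (++-is-foldr w (ρ i))) (sym (++-is-foldr w′ (ρ j))) p)))))
    preserve (φ ∧ ψ) with preserve φ | preserve ψ
    ... | r , f | r′ , g = r ⊔ r′ , λ sim (p , q) →
      f (similar-≤ (m≤m⊔n r r′) sim) p , g (similar-≤ (m≤n⊔m r r′) sim) q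
    preserve (φ ∨ ψ) with preserve φ | preserve ψ
    ... | r , f | r′ , g = r ⊔ r′ , λ sim → λ
      { (inj₁ p) → inj₁ (f (similar-≤ (m≤m⊔n r r′) sim) p)
      ; (inj₂ q) → inj₂ (g (similar-≤ (m≤n⊔m r r′) sim) q) }
    preserve (φ ⇒ ψ) with preserve φ | preserve ψ
    ... | r , f | r′ , g = r ⊔ r′ , λ sim h p →
      g (similar-≤ (m≤n⊔m r r′) sim) (h (f (similar-sym (similar-≤ (m≤m⊔n r r′) sim)) p))
    preserve {m} (∀′ φ) with preserve φ
    ... | r , f = proj₁ (extend m r) , λ sim h y →
      let x , sim′ = proj₂ (extend m r) (similar-sym sim) y in f (similar-sym sim′) (h x)
    preserve {m} (∃′ φ) with preserve φ
    ... | r , f = proj₁ (extend m r) , λ sim (x , p) →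
      let y , sim′ = proj₂ (extend m r) sim x in y , f sim′ p

    transferSentence : ∀ (φ : Sentence n) → ∃[ r ]
      (∀ S → Faithful r S → Free E ⊨ φ → Presented E S ⊨ φ)
    transferSentence φ with preserve φ
    ... | r , f = r , λ S S-faithful →
      f (similar (λ _ _ _ p → p) S-faithful (λ ()) (λ ()))

-- Weights on the free structure

δ : ∀ {n} → Fin n → Fin n → ℕ
δ zero    zero    = 1
δ zero    (suc i) = 0
δ (suc j) zero    = 0
δ (suc j) (suc i) = δ j i

δ-diagonal : ∀ {n} (j : Fin n) → δ j j ≡ 1
δ-diagonal zero    = refl
δ-diagonal (suc j) = δ-diagonal j

δ-≢ : ∀ {n} {i j : Fin n} → i ≢ j → δ i j ≡ 0
δ-≢ {i = zero}  {zero}  i≢j = ⊥-elim (i≢j refl)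
δ-≢ {i = zero}  {suc j} i≢j = refl
δ-≢ {i = suc i} {zero}  i≢j = refl
δ-≢ {i = suc i} {suc j} i≢j = δ-≢ (i≢j ∘ cong suc)

dot-zeroʳ : ∀ {n} (c : ℤ^ n) → dot c (const 0ℤ) ≡ 0ℤ
dot-zeroʳ {zero}  c = refl
dot-zeroʳ {suc n} c = cong₂ ℤ._+_ (ℤ.*-zeroʳ (c zero)) (dot-zeroʳ (c ∘ suc))

dot-δ : ∀ {n} (c : ℤ^ n) j → dot c (pos ∘ δ j) ≡ c j
dot-δ c zero    = trans (cong₂ ℤ._+_ (ℤ.*-identityʳ (c zero)) (dot-zeroʳ (c ∘ suc))) (ℤ.+-identityʳ _)
dot-δ c (suc j) = trans (cong₂ ℤ._+_ (ℤ.*-zeroʳ (c zero)) (dot-δ (c ∘ suc) j)) (ℤ.+-identityˡ _)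

occ : ∀ {n} → Word n → Fin n → ℕ
occ []      i = 0
occ (j ∷ u) i = δ j i + occ u i

occ-++ : ∀ {n} (u v : Word n) i → occ (u ++ v) i ≡ occ u i + occ v i
occ-++ []      v i = refl
occ-++ (j ∷ u) v i = trans (cong (δ j i +_) (occ-++ u v i)) (sym (+-assoc (δ j i) _ _))

occ⇒∈ : ∀ {n} (u : Word n) j → occ u j ≢ 0 → ∃[ as ] ∃[ bs ] u ≡ as ++ j ∷ bs
occ⇒∈ []      j occ≢0 = ⊥-elim (occ≢0 refl)
occ⇒∈ (i ∷ u) j occ≢0 with i Fin.≟ j
... | yes refl = [] , u , refl
... | no  i≢j  =
  let as , bs , eq = occ⇒∈ u j (λ occ≡0 → occ≢0 (cong₂ _+_ (δ-≢ i≢j) occ≡0))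
  in i ∷ as , bs , cong (i ∷_) eq

weight-occ : ∀ {n} (c : ℤ^ n) u → dot c (pos ∘ occ u) ≡ weight c u
weight-occ c [] = dot-zeroʳ c
weight-occ c (j ∷ u) = trans
  (dot-combination c 1ℤ (ℤ.- 1ℤ) (λ i → lemma (pos (δ j i)) (pos (occ u i))))
  (trans (sym (lemma (dot c (pos ∘ δ j)) (dot c (pos ∘ occ u)))) (cong₂ ℤ._+_ (dot-δ c j) (weight-occ c u)))
  where
  lemma : ∀ a b → a ℤ.+ b ≡ 1ℤ ℤ.* a ℤ.- (ℤ.- 1ℤ) ℤ.* b
  lemma = ℤSolver.solve-∀

power : ∀ {n} → ℕ → Word n → Word n
power zero    u = []
power (suc k) u = u ++ power k u

power-+ : ∀ {n} k l (u : Word n) → power (k + l) u ≡ power k u ++ power l u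
power-+ zero    l u = refl
power-+ (suc k) l u = trans (cong (u ++_) (power-+ k l u)) (sym (++-assoc u _ _))

occ-power : ∀ {n} k (u : Word n) i → occ (power k u) i ≡ k * occ u i
occ-power zero    u i = refl
occ-power (suc k) u i = trans (occ-++ u (power k u) i) (cong (occ u i +_) (occ-power k u i))

weight-power : ∀ {n} (c : ℤ^ n) k u → weight c (power k u) ≡ pos k ℤ.* weight c u
weight-power c zero    u = sym (ℤ.*-zeroˡ (weight c u))
weight-power c (suc k) u = trans (weight-++ c u (power k u))
  (trans (cong (ℤ._+_ (weight c u)) (weight-power c k u)) (sym (ℤ.suc-* (pos k) (weight c u))))

module Weights (em : ExcludedMiddle (lsuc 0ℓ)) {n : ℕ} (E : Axioms n)
  (bijective : GeneralizedBijective E) (commutative : Commutative E) where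

  open Relations em E bijective commutative

  power-cong : ∀ {S u v} k → u ≈[ S ] v → power k u ≈[ S ] power k v
  power-cong zero    p = ≈-refl
  power-cong (suc k) p = ++-cong p (power-cong k p)

  -- Letters commute, so the first letter of `u` can be brought to the front of `v` from wherever it
  -- occurs there, and then cancelled from both counts.
  occ-determines : ∀ u v → (∀ i → occ u i ≡ occ v i) → u ≈[ ∅ ] v
  occ-determines []      []      eq = ≈-refl
  occ-determines []      (j ∷ v) eq = ⊥-elim (m+1+n≢0 0 {occ v j}
    (sym (trans (eq j) (cong (_+ occ v j) (δ-diagonal j)))))
  occ-determines (j ∷ u) v       eq
    with occ⇒∈ v j (λ occ≡0 → m+1+n≢0 0 {occ u j}
           (trans (cong (_+ occ u j) (sym (δ-diagonal j))) (trans (eq j) occ≡0)))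
  ... | as , bs , refl = ≈-trans
    (∷-cong j (occ-determines u (as ++ bs) λ i → +-cancelˡ-≡ (δ j i) _ _ (trans (eq i) (eq′ i))))
    (x∙yz≈y∙xz (j ∷ []) as bs)
    where
    eq′ : ∀ i → occ (as ++ j ∷ bs) i ≡ δ j i + occ (as ++ bs) i
    eq′ i = trans (occ-++ as (j ∷ bs) i) (trans (lemma (occ as i) (δ j i) (occ bs i))
      (cong (δ j i +_) (sym (occ-++ as bs i))))
      where
      lemma : ∀ a d b → a + (d + b) ≡ d + (a + b)
      lemma = ℕSolver.solve-∀

  -- The kernel of the map from ℤⁿ onto the group of the free structure. Words have only nonnegative
  -- exponents, so a vector is represented as a difference of two occurrence vectors.
  record Relation (x : ℤ^ n) : Set₁ where
    constructor relation
    field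
      u v     : Word n
      holds   : u ≈[ ∅ ] v
      vector≡ : ∀ i → x i ≡ pos (occ u i) ℤ.- pos (occ v i)

  relation-+ : ∀ {x y z} → Relation x → Relation y → (∀ i → z i ≡ x i ℤ.+ y i) → Relation z
  relation-+ (relation u v p eq) (relation u′ v′ p′ eq′) z≡x+y = relation (u ++ u′) (v ++ v′) (++-cong p p′)
    λ i → trans (z≡x+y i) (trans (cong₂ ℤ._+_ (eq i) (eq′ i))
      (trans (lemma (pos (occ u i)) (pos (occ v i)) (pos (occ u′ i)) (pos (occ v′ i)))
        (sym (cong₂ (λ a b → pos a ℤ.- pos b) (occ-++ u u′ i) (occ-++ v v′ i)))))
    where
    lemma : ∀ a b c d → (a ℤ.- b) ℤ.+ (c ℤ.- d) ≡ (a ℤ.+ c) ℤ.- (b ℤ.+ d)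
    lemma = ℤSolver.solve-∀

  relation-* : ∀ p {x z} → Relation x → (∀ i → z i ≡ p ℤ.* x i) → Relation z
  relation-* p {x} {z} (relation u v e eq) z≡px with p
  ... | pos k = relation (power k u) (power k v) (power-cong k e)
    λ i → trans (z≡px i) (trans (cong (pos k ℤ.*_) (eq i))
      (trans (lemma (pos k) (pos (occ u i)) (pos (occ v i)))
        (sym (cong₂ ℤ._-_ (pos-occ-power u i) (pos-occ-power v i)))))
    where
    lemma : ∀ k a b → k ℤ.* (a ℤ.- b) ≡ k ℤ.* a ℤ.- k ℤ.* b
    lemma = ℤSolver.solve-∀
    pos-occ-power : ∀ w i → pos (occ (power k w) i) ≡ pos k ℤ.* pos (occ w i)
    pos-occ-power w i = trans (cong pos (occ-power k w i)) (ℤ.pos-* k (occ w i))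
  -- A negative factor exchanges the two sides of the relation.
  ... | -[1+ k ] = relation (power (suc k) v) (power (suc k) u) (power-cong (suc k) (≈-sym e))
    λ i → trans (z≡px i) (trans (cong (-[1+ k ] ℤ.*_) (eq i))
      (trans (lemma (pos (suc k)) (pos (occ u i)) (pos (occ v i)))
        (sym (cong₂ ℤ._-_ (pos-occ-power v i) (pos-occ-power u i)))))
    where
    lemma : ∀ k a b → (ℤ.- k) ℤ.* (a ℤ.- b) ≡ k ℤ.* b ℤ.- k ℤ.* a
    lemma = ℤSolver.solve-∀
    pos-occ-power : ∀ w i → pos (occ (power (suc k) w) i) ≡ pos (suc k) ℤ.* pos (occ w i)
    pos-occ-power w i = trans (cong pos (occ-power (suc k) w i)) (ℤ.pos-* (suc k) (occ w i))

  relation-submodule : IsSubmodule Relation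
  relation-submodule p q {x} {y} Rx Ry z≡ = relation-+
    (relation-* p Rx (λ _ → refl)) (relation-* (ℤ.- q) Ry (λ _ → refl))
    λ i → trans (z≡ i) (lemma p q (x i) (y i))
    where
    lemma : ∀ p q a b → p ℤ.* a ℤ.- q ℤ.* b ≡ p ℤ.* a ℤ.+ (ℤ.- q) ℤ.* b
    lemma = ℤSolver.solve-∀

  Torsion : Fin n → Set₁
  Torsion i = ∃[ m ] power (suc m) (i ∷ []) ≈[ ∅ ] []

  Invariant : ℤ^ n → Set₁
  Invariant c = ∀ u v → u ≈[ ∅ ] v → weight c u ≡ weight c v

  -- That `i` is not torsion means that no nonzero multiple of its unit vector is a relation, so
  -- `separate` provides a linear form vanishing on all relations but not on `i`. Vanishing on
  -- relations is invariance.
  invariantWeight : ∀ i → ¬ Torsion i → ∃[ c ] Invariant c × c i ≢ 0ℤ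
  invariantWeight i ¬torsion = c , invariant , λ ci≡0 → proj₂ (proj₂ sep) (trans (dot-δ c i) ci≡0)
    where
    torsion : ∀ m u v → v ≈[ ∅ ] u →
      (∀ j → occ u j ≡ suc m * δ i j + occ v j) → Torsion i
    torsion m u v v≈u eq = m , ++-cancelˡ-≈ v (≈-trans (++-comm v _)
      (≈-trans (occ-determines (power (suc m) (i ∷ []) ++ v) u λ j → sym (trans (eq j)
          (sym (trans (occ-++ (power (suc m) (i ∷ [])) v j)
            (cong (_+ occ v j) (trans (occ-power (suc m) (i ∷ []) j) (cong (suc m *_) (+-identityʳ (δ i j)))))))))
        (≈-trans (≈-sym v≈u) (reflexive (sym (++-identityʳ v))))))
    rearrange : ∀ a b k → pos a ℤ.- pos b ≡ pos k → a ≡ k + b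
    rearrange a b k eq = ℤ.+-injective (trans (lemma (pos a) (pos b)) (cong (ℤ._+ pos b) eq))
      where
      lemma : ∀ a b → a ≡ (a ℤ.- b) ℤ.+ b
      lemma = ℤSolver.solve-∀
    free : ∀ k x → k ≢ 0ℤ → Relation x → ¬ (∀ j → x j ≡ k ℤ.* pos (δ i j))
    free (pos zero)    x k≢0 _ _ = k≢0 refl
    free (pos (suc m)) x _ (relation u v u≈v x≡) x≡kδ = ¬torsion (torsion m u v (≈-sym u≈v) λ j →
      rearrange (occ u j) (occ v j) (suc m * δ i j)
        (trans (sym (x≡ j)) (trans (x≡kδ j) (sym (ℤ.pos-* (suc m) (δ i j))))))
    free -[1+ m ]      x _ (relation u v u≈v x≡) x≡kδ = ¬torsion (torsion m v u u≈v λ j →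
      rearrange (occ v j) (occ u j) (suc m * δ i j)
        (trans (lemma (pos (occ u j)) (pos (occ v j)))
          (trans (cong ℤ.-_ (trans (sym (x≡ j)) (x≡kδ j)))
            (trans (ℤ.neg-distribˡ-* -[1+ m ] (pos (δ i j))) (sym (ℤ.pos-* (suc m) (δ i j)))))))
      where
      lemma : ∀ a b → b ℤ.- a ≡ ℤ.- (a ℤ.- b)
      lemma = ℤSolver.solve-∀
    sep = separate em Relation relation-submodule (pos ∘ δ i) free
      (λ x x≡0 → relation [] [] ≈-refl x≡0)
    c = proj₁ sep
    invariant : Invariant c
    invariant u v u≈v = ℤ.i-j≡0⇒i≡j _ _ (trans (sym (cong₂ ℤ._-_ (weight-occ c u) (weight-occ c v)))
      (trans (lemma (dot c (pos ∘ occ u)) (dot c (pos ∘ occ v)))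
        (trans (sym (dot-combination c 1ℤ 1ℤ (λ i → lemma (pos (occ u i)) (pos (occ v i)))))
          (proj₁ (proj₂ sep) _ (relation u v u≈v (λ _ → refl))))))
      where
      lemma : ∀ a b → a ℤ.- b ≡ 1ℤ ℤ.* a ℤ.- 1ℤ ℤ.* b
      lemma = ℤSolver.solve-∀

  -- Finiteness when every generator is torsion

  module _ (torsion : ∀ i → Torsion i) where

    -- One less than some exponent that kills the generator; that exponent is a multiple of the
    -- order and need not equal it.
    order-1 : Fin n → ℕ
    order-1 i = proj₁ (torsion i)

    box : List (Fin n) → List (Word n)
    box []       = [] ∷ []
    box (i ∷ is) = cartesianProductWith (λ a w → power a (i ∷ []) ++ w) (upTo (suc (order-1 i))) (box is)

    ∈-box : ∀ i is {a w} → a ≤ order-1 i → w ∈ box is → power a (i ∷ []) ++ w ∈ box (i ∷ is)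
    ∈-box i is a≤ w∈ = ∈-cartesianProductWith⁺ (λ a w → power a (i ∷ []) ++ w) (∈-upTo⁺ (s≤s a≤)) w∈

    Boxed : List (Fin n) → Word n → Set₁
    Boxed is w = ∃[ x ] x ∈ box is × w ≈[ ∅ ] x

    boxed-[] : ∀ is → [] ∈ box is
    boxed-[] []       = here refl
    boxed-[] (i ∷ is) = ∈-box i is z≤n (boxed-[] is)

    boxed-∷ : ∀ {j} is {w} → j ∈ is → w ∈ box is → Boxed is (j ∷ w)
    boxed-∷ {j} (i ∷ is) j∈ w∈
      with a , w , a∈ , w∈is , refl ← ∈-cartesianProductWith⁻ (λ a w → power a (i ∷ []) ++ w)
             (upTo (suc (order-1 i))) (box is) w∈
      with j∈
    ... | there j∈is =
      let x , x∈ , jw≈x = boxed-∷ is j∈is w∈is in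
      power a (i ∷ []) ++ x , ∈-box i is (≤-pred (∈-upTo⁻ a∈)) x∈ ,
      ≈-trans (x∙yz≈y∙xz (j ∷ []) (power a (i ∷ [])) w) (++-congˡ (power a (i ∷ [])) jw≈x)
    ... | here refl with m≤n⇒m<n∨m≡n (≤-pred (∈-upTo⁻ a∈))
    ... | inj₁ a<m  = power (suc a) (i ∷ []) ++ w , ∈-box i is a<m w∈is , ≈-refl
    -- The exponent was maximal, so one more letter completes a trivial power and the exponent wraps
    -- around to zero.
    ... | inj₂ refl = w , ∈-box i is z≤n w∈is , ++-cong (proj₂ (torsion i)) ≈-refl

    boxed : ∀ w → Boxed (allFin n) w
    boxed []      = [] , boxed-[] (allFin n) , ≈-refl
    boxed (i ∷ w) =
      let x , x∈ , w≈x = boxed w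
          y , y∈ , ix≈y = boxed-∷ (allFin n) (∈-allFin i) x∈
      in y , y∈ , ≈-trans (∷-cong i w≈x) ix≈y

    torsion⇒finite : ¬ Infinite (Free E)
    torsion⇒finite infinite = infinite (box (allFin n) , λ w →
      let x , x∈ , w≈x = boxed w in
      Any.map (λ { refl → follows w≈x }) x∈)

  -- For a constant weight, the weight of a word is its length times `c i`. A letter followed by its
  -- inverse word has positive length and weight zero, which would force `c i` to vanish.
  nonconstant : ∀ c → Invariant c → ∀ i → c i ≢ 0ℤ → ∃[ j ] c j ≢ c i
  nonconstant c invariant i ci≢0 with all? (λ j → c j ℤ.≟ c i)
  ... | no  ¬constant = ¬∀⟶∃¬ n _ (λ j → c j ℤ.≟ c i) ¬constant
  ... | yes constant  = ⊥-elim contra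
    where
    weight-constant : ∀ w → weight c w ≡ pos (length w) ℤ.* c i
    weight-constant []      = sym (ℤ.*-zeroˡ (c i))
    weight-constant (j ∷ w) = trans (cong₂ ℤ._+_ (constant j) (weight-constant w))
      (sym (ℤ.suc-* (pos (length w)) (c i)))
    contra : ⊥
    contra with ℤ.i*j≡0⇒i≡0∨j≡0 (pos (suc (length (proj₁ (inverseLetter i)))))
        (trans (sym (weight-constant (i ∷ proj₁ (inverseLetter i)))) (invariant _ [] (proj₂ (inverseLetter i))))
    ... | inj₂ ci≡0 = ci≢0 ci≡0

  infinite⇒weight : Infinite (Free E) → ∃[ c ] Invariant c × ∃[ j ] ∃[ i ] c j ≢ c i
  infinite⇒weight infinite with em {∃[ i ] ¬ Torsion i}
  ... | yes (i , ¬t) = let c , invariant , ci≢0 = invariantWeight i ¬t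
                           j , cj≢ci = nonconstant c invariant i ci≢0
                       in c , invariant , j , i , cj≢ci
  ... | no  ¬free = ⊥-elim (torsion⇒finite torsion infinite)
    where
    torsion : ∀ i → Torsion i
    torsion i with em {Torsion i}
    ... | yes t  = t
    ... | no  ¬t = ⊥-elim (¬free (i , ¬t))

  -- The congruence generated by one identity

  module _ (t t′ : Word n) where

    infix 4 _~_
    -- This says u - v = (l - k)(t - t′) in the free group of words, written without subtraction.
    -- Two natural numbers `k` and `l` allow multiples of either sign.
    _~_ : Word n → Word n → Set₁
    u ~ v = ∃[ k ] ∃[ l ] u ++ (power k t ++ power l t′) ≈[ ∅ ] v ++ (power k t′ ++ power l t)

    ~-coarse : ∀ {u v} → u ≈[ ∅ ] v → u ~ v
    ~-coarse p = 0 , 0 , ++-cong p ≈-refl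

    ~-sym : ∀ {u v} → u ~ v → v ~ u
    ~-sym {u} {v} (k , l , p) = l , k , ≈-trans (++-congˡ v (++-comm (power l t) (power k t′)))
      (≈-trans (≈-sym p) (++-congˡ u (++-comm (power k t) (power l t′))))

    ~-trans : ∀ {u v w} → u ~ v → v ~ w → u ~ w
    ~-trans {u} {v} {w} (k , l , p) (k′ , l′ , p′) = k + k′ , l + l′ , (begin
      u ++ (power (k + k′) t ++ power (l + l′) t′) ≈⟨ ++-congˡ u (split t t′) ⟩
      u ++ (A ++ A′)                               ≡⟨ ++-assoc u A A′ ⟨
      (u ++ A) ++ A′                               ≈⟨ ++-cong p ≈-refl ⟩
      (v ++ B) ++ A′                               ≡⟨ ++-assoc v B A′ ⟩
      v ++ (B ++ A′)                               ≈⟨ x∙yz≈y∙xz v B A′ ⟩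
      B ++ (v ++ A′)                               ≈⟨ ++-congˡ B p′ ⟩
      B ++ (w ++ B′)                               ≈⟨ x∙yz≈y∙xz B w B′ ⟩
      w ++ (B ++ B′)                               ≈⟨ ++-congˡ w (split t′ t) ⟨
      w ++ (power (k + k′) t′ ++ power (l + l′) t) ∎)
      where
      open S-Reasoning {∅}
      A = power k t ++ power l t′
      B = power k t′ ++ power l t
      A′ = power k′ t ++ power l′ t′
      B′ = power k′ t′ ++ power l′ t
      split : ∀ t t′ → power (k + k′) t ++ power (l + l′) t′ ≈[ ∅ ]
                       (power k t ++ power l t′) ++ (power k′ t ++ power l′ t′)
      split t t′ = ≈-trans (reflexive (cong₂ _++_ (power-+ k k′ t) (power-+ l l′ t′)))
        (interchange (power k t) (power k′ t) (power l t′) (power l′ t′))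

    ~-relation : t ~ t′
    -- With k = 0 and l = 1 the condition reads t + t′ = t′ + t.
    ~-relation = 0 , 1 , ≈-trans (++-congˡ t (reflexive (++-identityʳ t′)))
      (≈-trans (++-comm t t′) (++-congˡ t′ (reflexive (sym (++-identityʳ t)))))

    ~-isEquivalence : IsEquivalence _~_
    ~-isEquivalence = record
      { refl  = λ {u} → ~-coarse (≈-refl {x = u})
      ; sym   = λ {u v} → ~-sym {u} {v}
      ; trans = λ {u v w} → ~-trans {u} {v} {w}
      }

    ~-cong : ∀ i u v → u ~ v → i ∷ u ~ i ∷ v
    ~-cong i u v (k , l , p) = k , l , ∷-cong i p

    free⇒~ : ∀ u v → Follows E ∅ u v → u ~ v
    free⇒~ u v p = ~-coarse {u} {v} (entail p)

    private
      module Q = Quotient em E _~_ ~-isEquivalence ~-cong free⇒~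

    presented⇒~ : ∀ {u v} → u ≈[ ｛ t , t′ ｝ ] v → u ~ v
    presented⇒~ {u} {v} p = Q.follows⇒~ {｛ t , t′ ｝} {u} {v} (λ { refl → ~-relation }) (follows p)

    -- In the abelian group of words, u − v is d = l − k times t − t′; if d = 0,
    -- then u = v holds already in the free structure.
    presented-gap : ∀ c → Invariant c → ∀ {u v} → u ≈[ ｛ t , t′ ｝ ] v →
                    u ≈[ ∅ ] v ⊎ gap c t t′ ≤ gap c u v
    presented-gap c invariant {u} {v} p with presented⇒~ p
    ... | k , l , e with k ℕ.≟ l
    ... | yes refl = inj₁ (++-cancelˡ-≈ (power k t ++ power k t′)
      (≈-trans (++-comm _ u) (≈-trans e (≈-trans (++-congˡ v (++-comm (power k t′) (power k t))) (++-comm v _)))))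
    ... | no  k≢l  = inj₂ (begin
      gap c t t′                      ≤⟨ m≤n*m (gap c t t′) ∣ d ∣ {{ℕ.≢-nonZero d≢0}} ⟩
      ∣ d ∣ * gap c t t′              ≡⟨ ℤ.abs-* d _ ⟨
      ∣ d ℤ.* (weight c t ℤ.- weight c t′) ∣ ≡⟨ cong ∣_∣ difference ⟨
      gap c u v                       ∎)
      where
      open ≤-Reasoning
      d = pos l ℤ.- pos k
      d≢0 : ∣ d ∣ ≢ 0
      d≢0 d≡0 = k≢l (sym (ℤ.+-injective (ℤ.i-j≡0⇒i≡j (pos l) (pos k) (ℤ.∣i∣≡0⇒i≡0 d≡0))))
      weights : ∀ w x y → weight c (w ++ (power k x ++ power l y)) ≡
                          weight c w ℤ.+ (pos k ℤ.* weight c x ℤ.+ pos l ℤ.* weight c y)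
      weights w x y = trans (weight-++ c w _) (cong (ℤ._+_ (weight c w))
        (trans (weight-++ c (power k x) _) (cong₂ ℤ._+_ (weight-power c k x) (weight-power c l y))))
      difference : weight c u ℤ.- weight c v ≡ d ℤ.* (weight c t ℤ.- weight c t′)
      difference = trans (lemma₁ (weight c u) (weight c v) (pos k ℤ.* weight c t ℤ.+ pos l ℤ.* weight c t′))
        (trans (cong (λ x → x ℤ.- (weight c v ℤ.+ (pos k ℤ.* weight c t ℤ.+ pos l ℤ.* weight c t′)))
          (trans (sym (weights u t t′)) (trans (invariant _ _ e) (weights v t′ t))))
        (lemma₂ (weight c v) (pos k) (pos l) (weight c t) (weight c t′)))
        where
        lemma₁ : ∀ a b s → a ℤ.- b ≡ (a ℤ.+ s) ℤ.- (b ℤ.+ s)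
        lemma₁ = ℤSolver.solve-∀
        lemma₂ : ∀ b k l x y → (b ℤ.+ (k ℤ.* y ℤ.+ l ℤ.* x)) ℤ.- (b ℤ.+ (k ℤ.* x ℤ.+ l ℤ.* y)) ≡
                               (l ℤ.- k) ℤ.* (x ℤ.- y)
        lemma₂ = ℤSolver.solve-∀

-- Limiting density

∈⇒≤∑ : ∀ {A : Set} (f : A → ℕ) {x xs} → x ∈ xs → f x ≤ ∑ xs f
∈⇒≤∑ f (here refl)             = m≤m+n _ _
∈⇒≤∑ f (there {x = y} x∈xs) = ≤-trans (∈⇒≤∑ f x∈xs) (m≤n+m _ (f y))

length≤filter+count : ∀ {A : Set} {ℓ} {Q : Pred A ℓ} (Q? : Decidable Q) (q : A → Bool) →
  (∀ x → ¬ Q x → T (q x)) → ∀ xs → length xs ≤ length (filter Q? xs) + count xs q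
length≤filter+count Q? q ¬Q⇒q []       = z≤n
length≤filter+count Q? q ¬Q⇒q (x ∷ xs) with Q? x
... | yes _ = s≤s (≤-trans (length≤filter+count Q? q ¬Q⇒q xs)
                (+-monoʳ-≤ (length (filter Q? xs)) (m≤n+m _ (indicator (q x)))))
... | no ¬Qx with q x | ¬Q⇒q x ¬Qx
... | true | _ = ≤-trans (s≤s (length≤filter+count Q? q ¬Q⇒q xs))
                   (≤-reflexive (sym (+-suc (length (filter Q? xs)) _)))

-- The tolerance is (e + 1)/(d + 1), at least 1/(d + 1). The missing fraction is at most 1/(d + 2),
-- and this slightly larger denominator makes the inequality strict.
close-to-1 : ∀ a p d e .{{_ : NonZero p}} → a ≤ p → (p ∸ a) * (2 + d) ≤ p →
             ℚ.∣ (pos a ℚ./ p) ℚ.- 1ℚᵘ ∣ ℚ.< mkℚᵘ (pos (suc e)) d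
close-to-1 a p@(suc p′) d e a≤p gap≤p = *<* (subst₂ ℤ._<_ lhs rhs (+<+ (begin-strict
  (p ∸ a) * suc d   <⟨ scaled (p ∸ a) refl ⟩
  p                 ≤⟨ m≤n*m p (suc e) ⟩
  suc e * p         ∎)))
  where
  open ≤-Reasoning
  scaled : ∀ b → b ≡ p ∸ a → b * suc d < p
  scaled zero      _  = s≤s z≤n
  scaled b@(suc _) eq = <-≤-trans (*-monoʳ-< b (n<1+n (suc d))) (subst (λ x → x * (2 + d) ≤ p) (sym eq) gap≤p)
  numerator : ℤ.∣ pos a ℤ.* 1ℤ ℤ.+ -[1+ 0 ] ℤ.* pos p ∣ ≡ p ∸ a
  numerator = trans (cong ℤ.∣_∣ (trans (lemma (pos a) (pos p)) (ℤ.m-n≡m⊖n a p))) (ℤ.∣⊖∣-≤ a≤p)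
    where
    lemma : ∀ a b → a ℤ.* 1ℤ ℤ.+ (ℤ.- 1ℤ) ℤ.* b ≡ a ℤ.- b
    lemma = ℤSolver.solve-∀
  lhs : pos ((p ∸ a) * suc d) ≡ pos ℤ.∣ pos a ℤ.* 1ℤ ℤ.+ -[1+ 0 ] ℤ.* pos p ∣ ℤ.* pos (suc d)
  lhs = trans (ℤ.pos-* (p ∸ a) (suc d)) (cong (λ x → pos x ℤ.* pos (suc d)) (sym numerator))
  rhs : pos (suc e * p) ≡ pos (suc e) ℤ.* pos (suc (p′ * 1))
  rhs = trans (ℤ.pos-* (suc e) p) (cong (λ x → pos (suc e) ℤ.* pos (suc x)) (sym (*-identityʳ p′)))

module Density (em : ExcludedMiddle (lsuc 0ℓ)) {n : ℕ} (E : Axioms n)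
  (bijective : GeneralizedBijective E) (commutative : Commutative E)
  (infinite : Infinite (Free E)) (φ : Sentence n) (F⊨φ : Free E ⊨ φ) where

  open Relations em E bijective commutative
  open Games infinite
  open Weights em E bijective commutative

  private
    theWeight = infinite⇒weight infinite
    c = proj₁ theWeight
    invariant = proj₁ (proj₂ theWeight)
    r = proj₁ (transferSentence φ)
    -- The sum over all pairs of total length at most `r` bounds each single gap.
    N = ∑ (identities n r) λ (u , v) → gap c u v

  -- If the weight gap of `R` exceeds `N`, it exceeds the gap of every short pair, so
  -- `presented-gap` leaves only free identifications among short pairs. The structure is then
  -- faithful and inherits `φ`.
  fails⇒near : ∀ R → ¬ (⟨a∣_⟩ E R ⊨ φ) → T (near c N R)
  fails⇒near R@(t , t′) ¬R⊨φ = decidable-stable (T? (near c N R)) λ ¬near →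
    ¬R⊨φ (proj₂ (transferSentence φ) ｛ R ｝ (faithful ¬near) F⊨φ)
    where
    faithful : ¬ T (near c N R) → Faithful r ｛ R ｝
    faithful ¬near u v short p with presented-gap t t′ c invariant p
    ... | inj₁ u≈v = u≈v
    ... | inj₂ le  = ⊥-elim (¬near (≤⇒≤ᵇ (≤-trans le
      (∈⇒≤∑ (λ (u , v) → gap c u v) (∈-identities⁺ (u , v) short)))))

  φ? : Decidable (λ R → ⟨a∣_⟩ E R ⊨ φ)
  φ? R = em

  density : HasLimitingDensity em E φ 1ℚᵘ
  density (mkℚᵘ (pos zero) d)    (*<* (+<+ ()))
  density (mkℚᵘ -[1+ e ] d)      (*<* ())
  density (mkℚᵘ (pos (suc e)) d) _ = proj₁ negligible , λ s s₀≤s →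
    close-to-1 (P[_] em E φ s) (P n s) d e (length-filter φ? (identities n s)) (begin
      (P n s ∸ P[_] em E φ s) * (2 + d)
        ≤⟨ *-monoˡ-≤ (2 + d) (m≤n+o⇒m∸n≤o (P n s) (P[_] em E φ s)
             (length≤filter+count φ? (near c N) fails⇒near (identities n s))) ⟩
      count (identities n s) (near c N) * (2 + d)
        ≤⟨ proj₂ negligible s s₀≤s ⟩
      P n s ∎)
    where
    open ≤-Reasoning
    negligible : ∃[ s₀ ] (∀ s → s₀ ≤ s → count (identities n s) (near c N) * (2 + d) ≤ P n s)
    negligible = let _ , _ , i , j , ci≢cj = theWeight in near-negligible c i j ci≢cj N (2 + d)

theorem4p26 : (em : ExcludedMiddle (lsuc 0ℓ)) →
    ∀ (n : ℕ) (E : Axioms n) →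
    GeneralizedBijective E →
    Commutative E →
    Infinite (Free E) →
    ∀ (φ : Sentence n) →
    Free E ⊨ φ →
    HasLimitingDensity em E φ 1ℚᵘ
theorem4p26 em n E bijective commutative infinite φ F⊨φ =
  Density.density em E bijective commutative infinite φ F⊨φ
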